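{- Let $n$ be a positive odd integer. Then $$ \sum_{k=0}^{n-1}\frac{(aq;q^2)_k\,(-q/a;q^2)_k\, q^{2k}}{(q^2;q^2)_k} \equiv (-1)^{(n-1)/2} q^{(n^2-1)/2} \pmod{(1-aq^n)(a+q^n)}, $$ and $$ \sum_{k=0}^{n-1}\frac{(aq;q^2)_k\,(q/a;q^2)_k\, q^{2k}}{(q^2;q^2)_k} \equiv q^{(n^2-1)/2} \pmod{(1-aq^n)(a-q^n)}. $$
   Context: $a,q$ are indeterminates. The $q$-shifted factorial is $(y;q)_0=1$ and $(y;q)_m=(1-y)(1-yq)\cdots(1-yq^{m-1})$ for $m\geqslant1$. For rational functions $A,B$ and a polynomial $P$, $A\equiv B\pmod P$ means $A-B=P\cdot C/D$ for polynomials $C,D$ with $D$ coprime to $P$. -}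

module Defs where

open import Algebra.Bundles using (CommutativeRing; RawRing)
import Algebra.Definitions.RawSemiring as RawSemiringDefinitions
import Algebra.Properties.AbelianGroup as AbelianGroupProperties
import Algebra.Properties.CommutativeSemigroup as CommutativeSemigroupProperties
open import Data.List.Base using (List; []; _∷_; map)
open import Data.Nat.Base using (ℕ; zero; suc)
open import Data.Product.Base using (Σ; _×_; _,_; ∃-syntax)
open import Data.Rational.Base as ℚ using (ℚ)
import Data.Rational.Properties as ℚ
open import Data.Sum.Base using (_⊎_; inj₁; inj₂; [_,_]′)
open import Level using (Level; _⊔_; 0ℓ) renaming (suc to lsuc)
open import Relation.Binary.Definitions using (Decidable)
open import Relation.Binary.Structures using (IsEquivalence)
open import Relation.Binary.Bundles using (Setoid)
open import Relation.Binary.PropositionalEquality as ≡ using (_≡_)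
import Relation.Binary.Reasoning.Setoid as SetoidReasoning
open import Relation.Nullary using (Dec; yes; no)
import Relation.Nullary.Decidable as Dec

private
  variable
    c ℓ : Level

record DecidableDomain c ℓ : Set (lsuc (c ⊔ ℓ)) where
  field
    commutativeRing : CommutativeRing c ℓ
  open CommutativeRing commutativeRing public
  field
    _≟_           : Decidable _≈_
    1≉0           : 1# ≉ 0#
    *-zeroProduct : ∀ x y → x * y ≈ 0# → x ≈ 0# ⊎ y ≈ 0#

-- A list is read as its coefficients in increasing degree.  Trailing zeros are
-- allowed, so equality compares coefficients rather than lists.
module Polynomial (R : CommutativeRing c ℓ) where

  open CommutativeRing R
  open AbelianGroupProperties +-abelianGroup using () renaming (ε⁻¹≈ε to -0≈0)
  open CommutativeSemigroupProperties +-commutativeSemigroup using ()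
    renaming (interchange to +-interchange)

  coeff : List Carrier → ℕ → Carrier
  coeff []      _       = 0#
  coeff (x ∷ p) zero    = x
  coeff (x ∷ p) (suc i) = coeff p i

  infix 4 _≋_
  record _≋_ (p r : List Carrier) : Set ℓ where
    constructor mk≋
    field
      coeff≈ : ∀ i → coeff p i ≈ coeff r i
  open _≋_ public

  infixl 6 _⊕_
  _⊕_ : List Carrier → List Carrier → List Carrier
  []      ⊕ r       = r
  (x ∷ p) ⊕ []      = x ∷ p
  (x ∷ p) ⊕ (y ∷ r) = x + y ∷ p ⊕ r

  ⊖_ : List Carrier → List Carrier
  ⊖_ = map (-_)

  scale : Carrier → List Carrier → List Carrier
  scale x = map (x *_)

  infixl 7 _⊗_
  _⊗_ : List Carrier → List Carrier → List Carrier
  []      ⊗ r = []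
  (x ∷ p) ⊗ r = scale x r ⊕ (0# ∷ p ⊗ r)

  constant : Carrier → List Carrier
  constant x = x ∷ []

  X : List Carrier
  X = 0# ∷ 1# ∷ []

  coeff-⊕ : ∀ p r i → coeff (p ⊕ r) i ≈ coeff p i + coeff r i
  coeff-⊕ []      r       i       = sym (+-identityˡ _)
  coeff-⊕ (x ∷ p) []      i       = sym (+-identityʳ _)
  coeff-⊕ (x ∷ p) (y ∷ r) zero    = refl
  coeff-⊕ (x ∷ p) (y ∷ r) (suc i) = coeff-⊕ p r i

  coeff-⊖ : ∀ p i → coeff (⊖ p) i ≈ - coeff p i
  coeff-⊖ []      i       = sym -0≈0
  coeff-⊖ (x ∷ p) zero    = refl
  coeff-⊖ (x ∷ p) (suc i) = coeff-⊖ p i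

  coeff-scale : ∀ x p i → coeff (scale x p) i ≈ x * coeff p i
  coeff-scale x []      i       = sym (zeroʳ x)
  coeff-scale x (y ∷ p) zero    = refl
  coeff-scale x (y ∷ p) (suc i) = coeff-scale x p i

  ≋-isEquivalence : IsEquivalence _≋_
  ≋-isEquivalence = record
    { refl  = mk≋ λ _ → refl
    ; sym   = λ p≋r → mk≋ λ i → sym (coeff≈ p≋r i)
    ; trans = λ p≋r r≋s → mk≋ λ i → trans (coeff≈ p≋r i) (coeff≈ r≋s i)
    }

  ≋-setoid : Setoid c ℓ
  ≋-setoid = record { isEquivalence = ≋-isEquivalence }

  open IsEquivalence ≋-isEquivalence public using ()
    renaming (refl to ≋-refl; sym to ≋-sym; trans to ≋-trans)

  private
    module ≈-R = SetoidReasoning setoid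
    module ≋-R = SetoidReasoning ≋-setoid

  ∷-cong : ∀ {x y p r} → x ≈ y → p ≋ r → x ∷ p ≋ y ∷ r
  ∷-cong x≈y p≋r = mk≋ λ { zero → x≈y ; (suc i) → coeff≈ p≋r i }

  0∷[]≋[] : ∀ {x} → x ≈ 0# → x ∷ [] ≋ []
  0∷[]≋[] x≈0 = mk≋ λ { zero → x≈0 ; (suc i) → refl }

  ⊕-cong : ∀ {p p′ r r′} → p ≋ p′ → r ≋ r′ → p ⊕ r ≋ p′ ⊕ r′
  ⊕-cong {p} {p′} {r} {r′} e f = mk≋ λ i → begin
    coeff (p ⊕ r) i           ≈⟨ coeff-⊕ p r i ⟩
    coeff p i + coeff r i     ≈⟨ +-cong (coeff≈ e i) (coeff≈ f i) ⟩
    coeff p′ i + coeff r′ i   ≈⟨ coeff-⊕ p′ r′ i ⟨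
    coeff (p′ ⊕ r′) i         ∎
    where open ≈-R

  ⊕-comm : ∀ p r → p ⊕ r ≋ r ⊕ p
  ⊕-comm p r = mk≋ λ i →
    trans (coeff-⊕ p r i) (trans (+-comm _ _) (sym (coeff-⊕ r p i)))

  ⊕-assoc : ∀ p r s → (p ⊕ r) ⊕ s ≋ p ⊕ (r ⊕ s)
  ⊕-assoc p r s = mk≋ λ i → begin
    coeff ((p ⊕ r) ⊕ s) i                  ≈⟨ coeff-⊕ (p ⊕ r) s i ⟩
    coeff (p ⊕ r) i + coeff s i            ≈⟨ +-congʳ (coeff-⊕ p r i) ⟩
    coeff p i + coeff r i + coeff s i      ≈⟨ +-assoc _ _ _ ⟩
    coeff p i + (coeff r i + coeff s i)    ≈⟨ +-congˡ (coeff-⊕ r s i) ⟨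
    coeff p i + coeff (r ⊕ s) i            ≈⟨ coeff-⊕ p (r ⊕ s) i ⟨
    coeff (p ⊕ (r ⊕ s)) i                  ∎
    where open ≈-R

  ⊕-identityʳ : ∀ p → p ⊕ [] ≋ p
  ⊕-identityʳ p = ⊕-comm p []

  ⊕-interchange : ∀ p r s t → (p ⊕ r) ⊕ (s ⊕ t) ≋ (p ⊕ s) ⊕ (r ⊕ t)
  ⊕-interchange p r s t = mk≋ λ i → begin
    coeff ((p ⊕ r) ⊕ (s ⊕ t)) i                          ≈⟨ expand p r s t i ⟩
    coeff p i + coeff r i + (coeff s i + coeff t i)      ≈⟨ +-interchange _ _ _ _ ⟩
    coeff p i + coeff s i + (coeff r i + coeff t i)      ≈⟨ expand p s r t i ⟨
    coeff ((p ⊕ s) ⊕ (r ⊕ t)) i                          ∎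
    where
    open ≈-R
    expand : ∀ p r s t i → coeff ((p ⊕ r) ⊕ (s ⊕ t)) i
                         ≈ coeff p i + coeff r i + (coeff s i + coeff t i)
    expand p r s t i = trans (coeff-⊕ (p ⊕ r) (s ⊕ t) i)
                             (+-cong (coeff-⊕ p r i) (coeff-⊕ s t i))

  ⊖-cong : ∀ {p r} → p ≋ r → ⊖ p ≋ ⊖ r
  ⊖-cong {p} {r} e = mk≋ λ i →
    trans (coeff-⊖ p i) (trans (-‿cong (coeff≈ e i)) (sym (coeff-⊖ r i)))

  ⊖-inverseʳ : ∀ p → p ⊕ ⊖ p ≋ []
  ⊖-inverseʳ p = mk≋ λ i →
    trans (coeff-⊕ p (⊖ p) i) (trans (+-congˡ (coeff-⊖ p i)) (-‿inverseʳ _))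

  scale-cong : ∀ {x y p r} → x ≈ y → p ≋ r → scale x p ≋ scale y r
  scale-cong {x} {y} {p} {r} x≈y e = mk≋ λ i →
    trans (coeff-scale x p i) (trans (*-cong x≈y (coeff≈ e i)) (sym (coeff-scale y r i)))

  scale-⊕ : ∀ x p r → scale x (p ⊕ r) ≋ scale x p ⊕ scale x r
  scale-⊕ x p r = mk≋ λ i → begin
    coeff (scale x (p ⊕ r)) i                  ≈⟨ coeff-scale x (p ⊕ r) i ⟩
    x * coeff (p ⊕ r) i                        ≈⟨ *-congˡ (coeff-⊕ p r i) ⟩
    x * (coeff p i + coeff r i)                ≈⟨ distribˡ _ _ _ ⟩
    x * coeff p i + x * coeff r i
      ≈⟨ +-cong (coeff-scale x p i) (coeff-scale x r i) ⟨
    coeff (scale x p) i + coeff (scale x r) i  ≈⟨ coeff-⊕ (scale x p) (scale x r) i ⟨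
    coeff (scale x p ⊕ scale x r) i            ∎
    where open ≈-R

  scale-scale : ∀ x y p → scale x (scale y p) ≋ scale (x * y) p
  scale-scale x y p = mk≋ λ i → begin
    coeff (scale x (scale y p)) i  ≈⟨ coeff-scale x (scale y p) i ⟩
    x * coeff (scale y p) i        ≈⟨ *-congˡ (coeff-scale y p i) ⟩
    x * (y * coeff p i)            ≈⟨ *-assoc _ _ _ ⟨
    x * y * coeff p i              ≈⟨ coeff-scale (x * y) p i ⟨
    coeff (scale (x * y) p) i      ∎
    where open ≈-R

  scale-1 : ∀ p → scale 1# p ≋ p
  scale-1 p = mk≋ λ i → trans (coeff-scale 1# p i) (*-identityˡ _)

  scale-0 : ∀ {x} p → x ≈ 0# → scale x p ≋ []
  scale-0 {x} p x≈0 = mk≋ λ i →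
    trans (coeff-scale x p i) (trans (*-congʳ x≈0) (zeroˡ _))

  ⊗-congˡ : ∀ p {r s} → r ≋ s → p ⊗ r ≋ p ⊗ s
  ⊗-congˡ []      e = ≋-refl
  ⊗-congˡ (x ∷ p) e = ⊕-cong (scale-cong refl e) (∷-cong refl (⊗-congˡ p e))

  ⊗-zeroʳ : ∀ p → p ⊗ [] ≋ []
  ⊗-zeroʳ []      = ≋-refl
  ⊗-zeroʳ (x ∷ p) = ≋-trans (∷-cong refl (⊗-zeroʳ p)) (0∷[]≋[] refl)

  ⊗-∷ʳ : ∀ p y r → p ⊗ (y ∷ r) ≋ scale y p ⊕ (0# ∷ p ⊗ r)
  ⊗-∷ʳ []      y r = ≋-sym (0∷[]≋[] refl)
  ⊗-∷ʳ (x ∷ p) y r = ∷-cong (+-congʳ (*-comm x y)) (begin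
    scale x r ⊕ p ⊗ (y ∷ r)                  ≈⟨ ⊕-cong (≋-refl {scale x r}) (⊗-∷ʳ p y r) ⟩
    scale x r ⊕ (scale y p ⊕ (0# ∷ p ⊗ r))   ≈⟨ ⊕-assoc (scale x r) (scale y p) _ ⟨
    (scale x r ⊕ scale y p) ⊕ (0# ∷ p ⊗ r)   ≈⟨ ⊕-cong (⊕-comm (scale x r) (scale y p)) ≋-refl ⟩
    (scale y p ⊕ scale x r) ⊕ (0# ∷ p ⊗ r)   ≈⟨ ⊕-assoc (scale y p) (scale x r) _ ⟩
    scale y p ⊕ (scale x r ⊕ (0# ∷ p ⊗ r))   ∎)
    where open ≋-R

  ⊗-comm : ∀ p r → p ⊗ r ≋ r ⊗ p
  ⊗-comm []      r = ≋-sym (⊗-zeroʳ r)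
  ⊗-comm (x ∷ p) r =
    ≋-trans (⊕-cong (≋-refl {scale x r}) (∷-cong refl (⊗-comm p r))) (≋-sym (⊗-∷ʳ r x p))

  ⊗-cong : ∀ {p p′ r r′} → p ≋ p′ → r ≋ r′ → p ⊗ r ≋ p′ ⊗ r′
  ⊗-cong {p} {p′} {r} {r′} e f = begin
    p ⊗ r    ≈⟨ ⊗-congˡ p f ⟩
    p ⊗ r′   ≈⟨ ⊗-comm p r′ ⟩
    r′ ⊗ p   ≈⟨ ⊗-congˡ r′ e ⟩
    r′ ⊗ p′  ≈⟨ ⊗-comm r′ p′ ⟩
    p′ ⊗ r′  ∎
    where open ≋-R

  ⊗-distribˡ : ∀ p r s → p ⊗ (r ⊕ s) ≋ p ⊗ r ⊕ p ⊗ s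
  ⊗-distribˡ []      r s = ≋-refl
  ⊗-distribˡ (x ∷ p) r s = begin
    scale x (r ⊕ s) ⊕ (0# ∷ p ⊗ (r ⊕ s))
      ≈⟨ ⊕-cong (scale-⊕ x r s) (∷-cong (sym (+-identityˡ 0#)) (⊗-distribˡ p r s)) ⟩
    (scale x r ⊕ scale x s) ⊕ ((0# ∷ p ⊗ r) ⊕ (0# ∷ p ⊗ s))
      ≈⟨ ⊕-interchange (scale x r) (scale x s) (0# ∷ p ⊗ r) (0# ∷ p ⊗ s) ⟩
    (scale x r ⊕ (0# ∷ p ⊗ r)) ⊕ (scale x s ⊕ (0# ∷ p ⊗ s)) ∎
    where open ≋-R

  ⊗-distribʳ : ∀ p r s → (r ⊕ s) ⊗ p ≋ r ⊗ p ⊕ s ⊗ p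
  ⊗-distribʳ p r s = begin
    (r ⊕ s) ⊗ p    ≈⟨ ⊗-comm (r ⊕ s) p ⟩
    p ⊗ (r ⊕ s)    ≈⟨ ⊗-distribˡ p r s ⟩
    p ⊗ r ⊕ p ⊗ s  ≈⟨ ⊕-cong (⊗-comm p r) (⊗-comm p s) ⟩
    r ⊗ p ⊕ s ⊗ p  ∎
    where open ≋-R

  0∷-⊗ : ∀ {x} p r → x ≈ 0# → (x ∷ p) ⊗ r ≋ 0# ∷ p ⊗ r
  0∷-⊗ p r x≈0 = ⊕-cong (scale-0 r x≈0) ≋-refl

  ⊗-0∷ : ∀ {x} p r → x ≈ 0# → p ⊗ (x ∷ r) ≋ 0# ∷ p ⊗ r
  ⊗-0∷ {x} p r x≈0 = ≋-trans (⊗-∷ʳ p x r) (⊕-cong (scale-0 p x≈0) ≋-refl)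

  scale-⊗ : ∀ x p r → scale x p ⊗ r ≋ scale x (p ⊗ r)
  scale-⊗ x []      r = ≋-refl
  scale-⊗ x (y ∷ p) r = begin
    scale (x * y) r ⊕ (0# ∷ scale x p ⊗ r)
      ≈⟨ ⊕-cong (≋-sym (scale-scale x y r)) (∷-cong (sym (zeroʳ x)) (scale-⊗ x p r)) ⟩
    scale x (scale y r) ⊕ scale x (0# ∷ p ⊗ r)
      ≈⟨ scale-⊕ x (scale y r) (0# ∷ p ⊗ r) ⟨
    scale x (scale y r ⊕ (0# ∷ p ⊗ r)) ∎
    where open ≋-R

  ⊗-assoc : ∀ p r s → (p ⊗ r) ⊗ s ≋ p ⊗ (r ⊗ s)
  ⊗-assoc []      r s = ≋-refl
  ⊗-assoc (x ∷ p) r s = begin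
    (scale x r ⊕ (0# ∷ p ⊗ r)) ⊗ s          ≈⟨ ⊗-distribʳ s (scale x r) (0# ∷ p ⊗ r) ⟩
    scale x r ⊗ s ⊕ (0# ∷ p ⊗ r) ⊗ s        ≈⟨ ⊕-cong (scale-⊗ x r s) (0∷-⊗ (p ⊗ r) s refl) ⟩
    scale x (r ⊗ s) ⊕ (0# ∷ (p ⊗ r) ⊗ s)
      ≈⟨ ⊕-cong (≋-refl {scale x (r ⊗ s)}) (∷-cong refl (⊗-assoc p r s)) ⟩
    scale x (r ⊗ s) ⊕ (0# ∷ p ⊗ (r ⊗ s))    ∎
    where open ≋-R

  ⊗-identityˡ : ∀ p → constant 1# ⊗ p ≋ p
  ⊗-identityˡ p = begin
    scale 1# p ⊕ (0# ∷ [])  ≈⟨ ⊕-cong (scale-1 p) (0∷[]≋[] refl) ⟩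
    p ⊕ []                  ≈⟨ ⊕-identityʳ p ⟩
    p                       ∎
    where open ≋-R

  polynomialRing : CommutativeRing c ℓ
  polynomialRing = record
    { Carrier = List Carrier
    ; _≈_ = _≋_
    ; _+_ = _⊕_
    ; _*_ = _⊗_
    ; -_  = ⊖_
    ; 0#  = []
    ; 1#  = constant 1#
    ; isCommutativeRing = record
      { isRing = record
        { +-isAbelianGroup = record
          { isGroup = record
            { isMonoid = record
              { isSemigroup = record
                { isMagma = record
                  { isEquivalence = ≋-isEquivalence
                  ; ∙-cong = ⊕-cong
                  }
                ; assoc = ⊕-assoc
                }
              ; identity = (λ _ → ≋-refl) , ⊕-identityʳ
              }
            ; inverse = (λ p → ≋-trans (⊕-comm (⊖ p) p) (⊖-inverseʳ p)) , ⊖-inverseʳ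
            ; ⁻¹-cong = ⊖-cong
            }
          ; comm = ⊕-comm
          }
        ; *-cong = ⊗-cong
        ; *-assoc = ⊗-assoc
        ; *-identity = ⊗-identityˡ
                     , λ p → ≋-trans (⊗-comm p (constant 1#)) (⊗-identityˡ p)
        ; distrib = ⊗-distribˡ , ⊗-distribʳ
        }
      ; *-comm = ⊗-comm
      }
    }

module _ (R : DecidableDomain c ℓ) where

  open DecidableDomain R
  open Polynomial commutativeRing

  private
    ∷-≋[] : ∀ {x p} → x ≈ 0# → p ≋ [] → x ∷ p ≋ []
    ∷-≋[] x≈0 p≋[] = ≋-trans (∷-cong x≈0 p≋[]) (0∷[]≋[] refl)

    tail-≋[] : ∀ {x p} → x ∷ p ≋ [] → p ≋ []
    tail-≋[] e = mk≋ λ i → coeff≈ e (suc i)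

    ≋[]? : ∀ p → Dec (p ≋ [])
    ≋[]? []      = yes ≋-refl
    ≋[]? (x ∷ p) with x ≟ 0# | ≋[]? p
    ... | yes x≈0 | yes p≋[] = yes (∷-≋[] x≈0 p≋[])
    ... | no  x≉0 | _        = no λ e → x≉0 (coeff≈ e 0)
    ... | yes _   | no ¬p≋[] = no λ e → ¬p≋[] (tail-≋[] e)

    _≋?_ : Decidable _≋_
    []      ≋? r       = Dec.map′ ≋-sym ≋-sym (≋[]? r)
    (x ∷ p) ≋? []      = ≋[]? (x ∷ p)
    (x ∷ p) ≋? (y ∷ r) with x ≟ y | p ≋? r
    ... | yes x≈y | yes p≋r = yes (∷-cong x≈y p≋r)
    ... | no  x≉y | _       = no λ e → x≉y (coeff≈ e 0)
    ... | yes _   | no ¬p≋r = no λ e → ¬p≋r (mk≋ λ i → coeff≈ e (suc i))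

    ⊗-zeroProduct : ∀ p r → p ⊗ r ≋ [] → p ≋ [] ⊎ r ≋ []
    ⊗-zeroProduct []      r       e = inj₁ ≋-refl
    ⊗-zeroProduct (x ∷ p) []      e = inj₂ ≋-refl
    ⊗-zeroProduct (x ∷ p) (y ∷ r) e =
      [ (λ x≈0 → [ (λ p≋[] → inj₁ (∷-≋[] x≈0 p≋[])) , inj₂ ]′
          (⊗-zeroProduct p (y ∷ r) (tail-≋[] (≋-trans (≋-sym (0∷-⊗ p (y ∷ r) x≈0)) e))))
      , (λ y≈0 → [ inj₁ , (λ r≋[] → inj₂ (∷-≋[] y≈0 r≋[])) ]′
          (⊗-zeroProduct (x ∷ p) r (tail-≋[] (≋-trans (≋-sym (⊗-0∷ (x ∷ p) r y≈0)) e))))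
      ]′ (*-zeroProduct x y (trans (sym (+-identityʳ _)) (coeff≈ e 0)))

  polynomialDomain : DecidableDomain c ℓ
  polynomialDomain = record
    { commutativeRing = polynomialRing
    ; _≟_             = _≋?_
    ; 1≉0             = λ e → 1≉0 (coeff≈ e 0)
    ; *-zeroProduct   = ⊗-zeroProduct
    }

module FractionField (R : DecidableDomain c ℓ) where

  open DecidableDomain R

  record Fraction : Set (c ⊔ ℓ) where
    constructor fraction
    field
      num   : Carrier
      den   : Carrier
      den≉0 : den ≉ 0#
  open Fraction public

  infix 4 _≃_
  record _≃_ (x y : Fraction) : Set ℓ where
    constructor mk≃
    field
      cross : num x * den y ≈ num y * den x
  open _≃_ public

  *-≉0 : ∀ {x y} → x ≉ 0# → y ≉ 0# → x * y ≉ 0#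
  *-≉0 x≉0 y≉0 xy≈0 = [ x≉0 , y≉0 ]′ (*-zeroProduct _ _ xy≈0)

  embed : Carrier → Fraction
  embed x = fraction x 1# 1≉0

  addF : Fraction → Fraction → Fraction
  addF (fraction m d d≉0) (fraction n e e≉0) =
    fraction (m * e + n * d) (d * e) (*-≉0 d≉0 e≉0)

  mulF : Fraction → Fraction → Fraction
  mulF (fraction m d d≉0) (fraction n e e≉0) =
    fraction (m * n) (d * e) (*-≉0 d≉0 e≉0)

  negF : Fraction → Fraction
  negF (fraction m d d≉0) = fraction (- m) d d≉0

  -- Total, with the junk value 0 at 0.
  invF : Fraction → Fraction
  invF (fraction m d d≉0) with m ≟ 0#
  ... | yes _   = embed 0#
  ... | no  m≉0 = fraction d m m≉0

  fractionRawRing : RawRing (c ⊔ ℓ) ℓ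
  fractionRawRing = record
    { Carrier = Fraction
    ; _≈_ = _≃_
    ; _+_ = addF
    ; _*_ = mulF
    ; -_  = negF
    ; 0#  = embed 0#
    ; 1#  = embed 1#
    }

  open RawSemiringDefinitions (RawRing.rawSemiring rawRing) using (Coprime)

  infix 4 _≡_[mod_]
  _≡_[mod_] : Fraction → Fraction → Carrier → Set (c ⊔ ℓ)
  A ≡ B [mod P ] =
    ∃[ C ] ∃[ D ] Σ (D ≉ 0#) λ D≉0 →
      Coprime D P × addF A (negF B) ≃ mulF (embed P) (fraction C D D≉0)

ℚ-domain : DecidableDomain 0ℓ 0ℓ
ℚ-domain = record
  { commutativeRing = ℚ.+-*-commutativeRing
  ; _≟_             = ℚ._≟_
  ; 1≉0             = λ ()
  ; *-zeroProduct   = zeroProduct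
  }
  where
  zeroProduct : ∀ x y → x ℚ.* y ≡ ℚ.0ℚ → x ≡ ℚ.0ℚ ⊎ y ≡ ℚ.0ℚ
  zeroProduct x y xy≡0 with x ℚ.≟ ℚ.0ℚ
  ... | yes x≡0 = inj₁ x≡0
  ... | no  x≢0 = inj₂ (begin
    y                          ≡⟨ ℚ.*-identityˡ y ⟨
    ℚ.1ℚ ℚ.* y                 ≡⟨ ≡.cong (ℚ._* y) (ℚ.*-inverseˡ x) ⟨
    (ℚ.1/ x) ℚ.* x ℚ.* y       ≡⟨ ℚ.*-assoc (ℚ.1/ x) x y ⟩
    (ℚ.1/ x) ℚ.* (x ℚ.* y)     ≡⟨ ≡.cong ((ℚ.1/ x) ℚ.*_) xy≡0 ⟩
    (ℚ.1/ x) ℚ.* ℚ.0ℚ          ≡⟨ ℚ.*-zeroʳ (ℚ.1/ x) ⟩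
    ℚ.0ℚ                       ∎)
    where
    open ≡.≡-Reasoning
    instance
      x-nonZero : ℚ.NonZero x
      x-nonZero = ℚ.≢-nonZero x≢0

ℚ[q] : DecidableDomain 0ℓ 0ℓ
ℚ[q] = polynomialDomain ℚ-domain

-- The polynomial ring ℚ[a,q], as (ℚ[q])[a].
ℚ[q][a] : DecidableDomain 0ℓ 0ℓ
ℚ[q][a] = polynomialDomain ℚ[q]

open DecidableDomain ℚ[q][a] public using ()
  renaming (Carrier to Poly; _+_ to _+ₚ_; _*_ to _*ₚ_; _-_ to _-ₚ_; 1# to 1ₚ)
open RawSemiringDefinitions
  (RawRing.rawSemiring (CommutativeRing.rawRing (DecidableDomain.commutativeRing ℚ[q][a]))) public
  using () renaming (_^_ to _^ₚ_)

aₚ qₚ : Poly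
aₚ = Polynomial.X (DecidableDomain.commutativeRing ℚ[q])
qₚ = Polynomial.constant (DecidableDomain.commutativeRing ℚ[q])
       (Polynomial.X (DecidableDomain.commutativeRing ℚ-domain))

open FractionField ℚ[q][a] public using (Fraction; embed; invF; _≡_[mod_])
open RawRing (FractionField.fractionRawRing ℚ[q][a]) public
  using (_+_; _*_; -_; 1#)
open RawSemiringDefinitions
  (RawRing.rawSemiring (FractionField.fractionRawRing ℚ[q][a])) public
  using (_^_; sum)

infixl 6 _-_
_-_ : Fraction → Fraction → Fraction
x - y = x + (- y)

infixl 7 _÷_
_÷_ : Fraction → Fraction → Fraction
x ÷ y = x * invF y

a q : Fraction
a = embed aₚ
q = embed qₚ

-- qPoch y b m is the q-shifted factorial (y;b)_m.
qPoch : Fraction → Fraction → ℕ → Fraction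
qPoch y b zero    = 1#
qPoch y b (suc m) = qPoch y b m * (1# - y * b ^ m)

{-# OPTIONS --safe #-}

-- Put Q = q², n = 2N + 1, x = aq and y = ηq/a with η = ∓1, so that xy = ηQ.
-- The elements X = Q⁻ᴺ and Y = ηQᴺ⁺¹ have the same product, hence
-- (1 − xQʲ)(1 − yQʲ) and (1 − XQʲ)(1 − YQʲ) differ by Qʲ(X + Y − x − y), and the
-- modulus (1 − aqⁿ)(a − ηqⁿ) is aQᴺ(X + Y − x − y).  Modulo it, the sum therefore
-- becomes the terminating sum Σ (Q⁻ᴺ;Q)ₖ (Y;Q)ₖ Qᵏ/(Q;Q)ₖ = Yᴺ, which is
-- q-Chu-Vandermonde with lower parameter 0.  All quotients lie in the ring of
-- fractions whose denominators have the form aᵐd(q); such a denominator is coprime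
-- to the modulus because the modulus, as a polynomial in a, is primitive and has
-- nonzero constant term.
module Submission where

open import Algebra.Bundles using (CommutativeRing; RawRing)
open import Algebra.Definitions.RawMagma using () renaming (_,_ to infixr 4 _∣,_)
import Algebra.Definitions.RawSemiring as RawSemiringDefinitions
import Algebra.Properties.AbelianGroup as AbelianGroupProperties
import Algebra.Properties.CommutativeSemigroup as CommutativeSemigroupProperties
import Algebra.Properties.CommutativeSemiring.Exp as Exponentiation
import Algebra.Properties.Ring as RingProperties
import Algebra.Properties.Semiring.Mult.TCOptimised as Multiplication
import Algebra.Properties.Semiring.Sum as Summation
import Algebra.Solver.Ring as RingSolver
open import Algebra.Solver.Ring.AlmostCommutativeRing using (_-Raw-AlmostCommutative⟶_; fromCommutativeRing)
open import Data.Fin.Base using (Fin; toℕ) renaming (zero to fzero; suc to fsuc)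
open import Data.List.Base using (List; []; _∷_)
open import Data.Maybe.Base using (Maybe; just; nothing)
open import Data.Nat.Base as ℕ using (ℕ; zero; suc; s≤s; z≤n; _<_; _∸_)
open import Data.Nat.Base using () renaming (_^_ to _^ℕ_; _*_ to _*ℕ_)
open import Data.Nat.Divisibility using (_∣_; divides)
open import Data.Nat.DivMod using (_/_; m*n/n≡m)
import Data.Nat.Properties as ℕ
open import Data.Nat.Solver using (module +-*-Solver)
open import Data.Product.Base using (_×_; _,_; ∃-syntax; proj₁; proj₂)
open import Data.Sum.Base using (_⊎_; inj₁; inj₂; [_,_]′)
open import Level using (Level; _⊔_)
open import Relation.Binary.PropositionalEquality as ≡ using (_≡_)
import Relation.Binary.Reasoning.Setoid as SetoidReasoning
open import Relation.Nullary using (¬_; yes; no; contradiction)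
open import Defs using (DecidableDomain; module FractionField; module Polynomial; polynomialDomain; ℚ-domain; ℚ[q]; ℚ[q][a])

-- The choice of `X` and `Y` comes from the roots of the modulus in a: at a = q⁻ⁿ the pair (x , y)
-- becomes (X , Y), and at a = ηqⁿ it becomes (Y , X). The summand is symmetric in x and y, so both
-- roots lead to the same terminating sum, and the symmetric quantity X + Y - x - y handles them in
-- one identity instead of combining two congruences. Each congruence is carried as an equation with
-- an explicit quotient together with a proof that this quotient lies in a subring `S`. Without the
-- membership it would say nothing: in the fraction field every difference is a multiple of the
-- nonzero modulus.

private
  variable
    c ℓ : Level

-- A ring solver with integer coefficients.

-- The ring solver over an arbitrary commutative ring cannot test its own
-- coefficients for zero, so coefficients are taken to be formal differences
-- (m , n) of natural numbers.
module DifferenceSolver (R : CommutativeRing c ℓ) where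

  open CommutativeRing R
  open Multiplication semiring using (×-homo-+; ×1-homo-*) renaming (_×_ to _·_)
  open RingProperties ring using (-‿distribˡ-*; -‿distribʳ-*; -‿+-comm; -‿involutive; -0#≈0#)
  open CommutativeSemigroupProperties +-commutativeSemigroup using (interchange)
  open SetoidReasoning setoid

  private
    -- The case `n = 0` is split off so that `(1 , 0)` and `(0 , 0)` compute to `1#` and `0#`
    -- themselves, and solved equations match goals containing these constants.
    ⟦_⟧ : ℕ × ℕ → Carrier
    ⟦ m , zero ⟧      = m · 1#
    ⟦ m , n@(suc _) ⟧ = m · 1# - n · 1#

    ⟦⟧-difference : ∀ m n → ⟦ m , n ⟧ ≈ m · 1# - n · 1#
    ⟦⟧-difference m zero    = sym (trans (+-congˡ -0#≈0#) (+-identityʳ _))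
    ⟦⟧-difference m (suc n) = refl

    +-difference : ∀ w x y z → (w + y) - (x + z) ≈ (w - x) + (y - z)
    +-difference w x y z = trans (+-congˡ (sym (-‿+-comm x z))) (interchange w y (- x) (- z))

    neg-difference : ∀ x y → y - x ≈ - (x - y)
    neg-difference x y = begin
      y - x          ≈⟨ +-comm y (- x) ⟩
      - x + y        ≈⟨ +-congˡ (-‿involutive y) ⟨
      - x + - (- y)  ≈⟨ -‿+-comm x (- y) ⟩
      - (x - y)      ∎

    *-difference : ∀ w x y z → (w * y + x * z) - (w * z + x * y) ≈ (w - x) * (y - z)
    *-difference w x y z = begin
      (w * y + x * z) - (w * z + x * y)      ≈⟨ +-difference _ _ _ _ ⟩
      (w * y - w * z) + (x * z - x * y)      ≈⟨ +-congˡ (neg-difference (x * y) (x * z)) ⟩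
      (w * y - w * z) - (x * y - x * z)      ≈⟨ +-cong (expand w) (-‿cong (expand x)) ⟨
      w * (y - z) - x * (y - z)              ≈⟨ +-congˡ (-‿distribˡ-* x (y - z)) ⟩
      w * (y - z) + - x * (y - z)            ≈⟨ distribʳ (y - z) w (- x) ⟨
      (w - x) * (y - z)                      ∎
      where
      expand : ∀ v → v * (y - z) ≈ v * y - v * z
      expand v = trans (distribˡ v y (- z)) (+-congˡ (sym (-‿distribʳ-* v z)))

    differences : RawRing _ _
    differences = record
      { Carrier = ℕ × ℕ
      ; _≈_     = _≡_
      ; _+_     = λ { (m , n) (m′ , n′) → m ℕ.+ m′ , n ℕ.+ n′ }
      ; _*_     = λ { (m , n) (m′ , n′) → m ℕ.* m′ ℕ.+ n ℕ.* n′ , m ℕ.* n′ ℕ.+ n ℕ.* m′ }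
      ; -_      = λ { (m , n) → n , m }
      ; 0#      = 0 , 0
      ; 1#      = 1 , 0
      }

    *-sum : ∀ k l m n → (k ℕ.* l ℕ.+ m ℕ.* n) · 1# ≈ k · 1# * l · 1# + m · 1# * n · 1#
    *-sum k l m n =
      trans (×-homo-+ 1# (k ℕ.* l) (m ℕ.* n)) (+-cong (×1-homo-* k l) (×1-homo-* m n))

    homomorphism : differences -Raw-AlmostCommutative⟶ fromCommutativeRing R
    homomorphism = record
      { ⟦_⟧    = ⟦_⟧
      ; +-homo = λ { (m , n) (m′ , n′) → begin
          ⟦ m ℕ.+ m′ , n ℕ.+ n′ ⟧                              ≈⟨ ⟦⟧-difference _ (n ℕ.+ n′) ⟩
          (m ℕ.+ m′) · 1# - (n ℕ.+ n′) · 1#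
            ≈⟨ +-cong (×-homo-+ 1# m m′) (-‿cong (×-homo-+ 1# n n′)) ⟩
          (m · 1# + m′ · 1#) - (n · 1# + n′ · 1#)              ≈⟨ +-difference _ _ _ _ ⟩
          (m · 1# - n · 1#) + (m′ · 1# - n′ · 1#)
            ≈⟨ +-cong (⟦⟧-difference m n) (⟦⟧-difference m′ n′) ⟨
          ⟦ m , n ⟧ + ⟦ m′ , n′ ⟧                              ∎ }
      ; *-homo = λ { (m , n) (m′ , n′) → begin
          ⟦ m ℕ.* m′ ℕ.+ n ℕ.* n′ , m ℕ.* n′ ℕ.+ n ℕ.* m′ ⟧    ≈⟨ ⟦⟧-difference _ (m ℕ.* n′ ℕ.+ n ℕ.* m′) ⟩
          (m ℕ.* m′ ℕ.+ n ℕ.* n′) · 1# - (m ℕ.* n′ ℕ.+ n ℕ.* m′) · 1#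
            ≈⟨ +-cong (*-sum m m′ n n′) (-‿cong (*-sum m n′ n m′)) ⟩
          (m · 1# * m′ · 1# + n · 1# * n′ · 1#) - (m · 1# * n′ · 1# + n · 1# * m′ · 1#)
            ≈⟨ *-difference _ _ _ _ ⟩
          (m · 1# - n · 1#) * (m′ · 1# - n′ · 1#)
            ≈⟨ *-cong (⟦⟧-difference m n) (⟦⟧-difference m′ n′) ⟨
          ⟦ m , n ⟧ * ⟦ m′ , n′ ⟧                              ∎ }
      ; -‿homo = λ { (m , n) →
          trans (⟦⟧-difference n m)
            (trans (neg-difference _ _) (-‿cong (sym (⟦⟧-difference m n)))) }
      ; 0-homo = refl
      ; 1-homo = refl
      }

    cancel-difference : ∀ {w x y z} → w + z ≈ y + x → w - x ≈ y - z
    cancel-difference {w} {x} {y} {z} e = begin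
      w - x                ≈⟨ shift w x z ⟩
      (w + z) - (x + z)    ≈⟨ +-cong e (-‿cong (+-comm x z)) ⟩
      (y + x) - (z + x)    ≈⟨ shift y z x ⟨
      y - z                ∎
      where
      shift : ∀ u v t → u - v ≈ (u + t) - (v + t)
      shift u v t = begin
        u - v                ≈⟨ +-identityʳ _ ⟨
        (u - v) + 0#         ≈⟨ +-congˡ (-‿inverseʳ t) ⟨
        (u - v) + (t - t)    ≈⟨ +-difference u v t t ⟨
        (u + t) - (v + t)    ∎

    -- Pairs are compared as integers, by cross sums. In positive characteristic unequal integers
    -- may still have equal images, hence `Maybe` rather than a decision.
    ⟦⟧-dec : ∀ x y → Maybe (⟦ x ⟧ ≈ ⟦ y ⟧)
    ⟦⟧-dec (m , n) (m′ , n′) with m ℕ.+ n′ ℕ.≟ m′ ℕ.+ n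
    ... | no  _ = nothing
    ... | yes e = just (trans (⟦⟧-difference m n) (trans (cancel-difference cross) (sym (⟦⟧-difference m′ n′))))
      where
      cross : m · 1# + n′ · 1# ≈ m′ · 1# + n · 1#
      cross = trans (sym (×-homo-+ 1# m n′))
                (trans (reflexive (≡.cong (_· 1#) e)) (×-homo-+ 1# m′ n))

  open RingSolver differences (fromCommutativeRing R) homomorphism ⟦⟧-dec public
    using (solve; con; _:=_; _:+_; _:*_; _:-_; :-_) renaming (Polynomial to Expr)

  :1 : ∀ {n} → Expr n
  :1 = con (1 , 0)

  :0 : ∀ {n} → Expr n
  :0 = con (0 , 0)

-- Subrings of a commutative ring.

module _ (R : CommutativeRing c ℓ) where

  open CommutativeRing R
  open Exponentiation commutativeSemiring using (_^_)

  1^k≈1 : ∀ k → 1# ^ k ≈ 1#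
  1^k≈1 zero    = refl
  1^k≈1 (suc k) = trans (*-identityˡ _) (1^k≈1 k)

  record IsSubring {p} (S : Carrier → Set p) : Set (c ⊔ ℓ ⊔ p) where
    field
      0∈ : S 0#
      1∈ : S 1#
      +∈ : ∀ {x y} → S x → S y → S (x + y)
      *∈ : ∀ {x y} → S x → S y → S (x * y)
      -∈ : ∀ {x} → S x → S (- x)

    ^∈ : ∀ {x} → S x → ∀ k → S (x ^ k)
    ^∈ x∈ zero    = 1∈
    ^∈ x∈ (suc k) = *∈ x∈ (^∈ x∈ k)

-- Terminating q-series: contiguous relation, q-Chu-Vandermonde, congruence.

module QSeries (R : CommutativeRing c ℓ) (Q : CommutativeRing.Carrier R) where

  open CommutativeRing R
  open Exponentiation commutativeSemiring using (_^_; ^-congˡ; ^-distrib-*)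
  open Summation semiring using (sum; sum-cong-≋; sum-replicate-zero)
  open DifferenceSolver R
  open SetoidReasoning setoid

  poch : Carrier → ℕ → Carrier
  poch x zero    = 1#
  poch x (suc k) = poch x k * (1# - x * Q ^ k)

  poch-cong : ∀ {x y} → x ≈ y → ∀ k → poch x k ≈ poch y k
  poch-cong x≈y zero    = refl
  poch-cong x≈y (suc k) = *-cong (poch-cong x≈y k) (+-congˡ (-‿cong (*-congʳ x≈y)))

  poch-suc : ∀ x k → poch x (suc k) ≈ (1# - x) * poch (x * Q) k
  poch-suc x zero    = solve 1 (λ x → :1 :* (:1 :- x :* :1) := (:1 :- x) :* :1) refl x
  poch-suc x (suc k) = trans (*-congʳ (poch-suc x k))
    (solve 4 (λ x p Q s → (:1 :- x) :* p :* (:1 :- x :* (Q :* s))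
                       := (:1 :- x) :* (p :* (:1 :- x :* Q :* s)))
      refl x (poch (x * Q) k) Q (Q ^ k))

  sum-linear : ∀ {m} y (f g h : Fin m → Carrier) → (∀ i → f i ≈ g i + y * h i) →
               sum f ≈ sum g + y * sum h
  sum-linear {zero}  y f g h e = solve 1 (λ y → :0 := :0 :+ y :* :0) refl y
  sum-linear {suc m} y f g h e =
    trans (+-cong (e fzero) (sum-linear y (λ i → f (fsuc i)) (λ i → g (fsuc i)) (λ i → h (fsuc i))
                              (λ i → e (fsuc i))))
      (solve 5 (λ y g h G H → g :+ y :* h :+ (G :+ y :* H) := g :+ G :+ y :* (h :+ H))
        refl y (g fzero) (h fzero) _ _)

  -- `e k` stands for 1/(Q;Q)ₖ. Supplying the inverses as data lets the argument run in any
  -- commutative ring that has them.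
  module _ (e : ℕ → Carrier) (e-inverse : ∀ k → poch Q k * e k ≈ 1#) where

    e-pred : ∀ k → e k ≈ (1# - Q * Q ^ k) * e (suc k)
    e-pred k = begin
      e k                                                          ≈⟨ *-identityʳ _ ⟨
      e k * 1#                                                     ≈⟨ *-congˡ (e-inverse (suc k)) ⟨
      e k * (poch Q k * (1# - Q * Q ^ k) * e (suc k))
        ≈⟨ solve 4 (λ x p f y → x :* (p :* f :* y) := p :* x :* (f :* y)) refl _ _ _ _ ⟩
      poch Q k * e k * ((1# - Q * Q ^ k) * e (suc k))              ≈⟨ *-congʳ (e-inverse k) ⟩
      1# * ((1# - Q * Q ^ k) * e (suc k))                          ≈⟨ *-identityˡ _ ⟩
      (1# - Q * Q ^ k) * e (suc k)                                 ∎

    term : Carrier → Carrier → ℕ → Carrier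
    term x y k = poch x k * poch y k * Q ^ k * e k

    series : ℕ → Carrier → Carrier → Carrier
    series m x y = sum {m} (λ i → term x y (toℕ i))

    -- Split 1 - x = (1 - xQᵏ⁺¹) - x(1 - Qᵏ⁺¹). The first part completes (xQ;Q)ₖ to (xQ;Q)ₖ₊₁; the
    -- second cancels the last factor of (Q;Q)ₖ₊₁ and so lowers the index.
    term-contiguous : ∀ x y k → term x y (suc k) ≈
                      term (x * Q) y (suc k) + - (x * Q * (1# - y)) * term (x * Q) (y * Q) k
    term-contiguous x y k = begin
      term x y (suc k)
        ≈⟨ *-congʳ (*-congʳ (*-cong (poch-suc x k) (poch-suc y k))) ⟩
      (1# - x) * p * ((1# - y) * r) * (Q * s) * e (suc k)
        ≈⟨ solve 7 (λ x y p r Q s e →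
              (:1 :- x) :* p :* ((:1 :- y) :* r) :* (Q :* s) :* e
              := p :* (:1 :- x :* Q :* s) :* ((:1 :- y) :* r) :* (Q :* s) :* e
                 :+ (:- (x :* Q :* (:1 :- y))) :* (p :* r :* s :* ((:1 :- Q :* s) :* e)))
              refl x y p r Q s (e (suc k)) ⟩
      p * (1# - x * Q * s) * ((1# - y) * r) * (Q * s) * e (suc k)
        + - (x * Q * (1# - y)) * (p * r * s * ((1# - Q * s) * e (suc k)))
        ≈⟨ +-cong (*-congʳ (*-congʳ (*-congˡ (poch-suc y k)))) (*-congˡ (*-congˡ (e-pred k))) ⟨
      term (x * Q) y (suc k) + - (x * Q * (1# - y)) * term (x * Q) (y * Q) k ∎
      where
      p = poch (x * Q) k
      r = poch (y * Q) k
      s = Q ^ k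

    series-contiguous : ∀ m x y → series (suc m) x y ≈
                        series (suc m) (x * Q) y + - (x * Q * (1# - y)) * series m (x * Q) (y * Q)
    series-contiguous m x y = trans
      -- The terms at k = 0 agree by computation, so only the tails are compared; this is why the
      -- last series has length `m` and not `suc m`.
      (+-congˡ (sum-linear {m} (- (x * Q * (1# - y)))
        (λ i → term x y (suc (toℕ i))) (λ i → term (x * Q) y (suc (toℕ i))) (λ i → term (x * Q) (y * Q) (toℕ i))
        (λ i → term-contiguous x y (toℕ i))))
      (sym (+-assoc _ _ _))

    series-cong : ∀ m {x x′ y y′} → x ≈ x′ → y ≈ y′ → series m x y ≈ series m x′ y′
    series-cong m x≈x′ y≈y′ = sum-cong-≋ {m} λ i →
      *-congʳ (*-congʳ (*-cong (poch-cong x≈x′ (toℕ i)) (poch-cong y≈y′ (toℕ i))))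

    module _ (Q⁻¹ : Carrier) (Q⁻¹-inverse : Q⁻¹ * Q ≈ 1#) where

      ^-inverse : ∀ k → Q⁻¹ ^ k * Q ^ k ≈ 1#
      ^-inverse k = trans (sym (^-distrib-* Q⁻¹ Q k)) (trans (^-congˡ k Q⁻¹-inverse) (1^k≈1 R k))

      -- The q-Chu-Vandermonde sum ₂φ₁(Q⁻ᴺ, y; 0; Q, Q) = yᴺ.
      chuVandermonde : ∀ N m y → N ℕ.< m → series m (Q⁻¹ ^ N) y ≈ y ^ N
      chuVandermonde zero (suc m) y _ = begin
        term 1# y 0 + sum {m} (λ i → term 1# y (suc (toℕ i)))
          ≈⟨ +-cong head (trans (sum-cong-≋ {m} λ i → vanish (toℕ i)) (sum-replicate-zero m)) ⟩
        1# + 0#     ≈⟨ +-identityʳ 1# ⟩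
        1#          ∎
        where
        head : term 1# y 0 ≈ 1#
        head = trans (*-congʳ (trans (*-identityʳ _) (*-identityʳ _))) (e-inverse 0)
        vanish : ∀ k → term 1# y (suc k) ≈ 0#
        -- For N = 0 the upper parameter is 1, and (1;Q)ₖ₊₁ begins with the factor 1 - 1.
        vanish k = trans (*-congʳ (*-congʳ (*-congʳ (poch-suc 1# k))))
          (solve 4 (λ p r s e → (:1 :- :1) :* p :* r :* s :* e := :0) refl _ _ _ _)
      -- The contiguous relation raises Q⁻ᴺ⁻¹ to Q⁻ᴺ in both series, leaving yᴺ - Q⁻ᴺ(1 - y)(yQ)ᴺ =
      -- yᴺ⁺¹. The induction must allow y to vary, since the second series has yQ.
      chuVandermonde (suc N) (suc m) y (s≤s N<m) = begin
        series (suc m) X′ y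
          ≈⟨ series-contiguous m X′ y ⟩
        series (suc m) (X′ * Q) y + - (X′ * Q * (1# - y)) * series m (X′ * Q) (y * Q)
          ≈⟨ +-cong (series-cong (suc m) X′Q≈X refl)
               (*-cong (-‿cong (*-congʳ X′Q≈X)) (series-cong m X′Q≈X refl)) ⟩
        series (suc m) X y + - (X * (1# - y)) * series m X (y * Q)
          ≈⟨ +-cong (chuVandermonde N (suc m) y (ℕ.m<n⇒m<1+n N<m))
               (*-congˡ (trans (chuVandermonde N m (y * Q) N<m) (^-distrib-* y Q N))) ⟩
        y ^ N + - (X * (1# - y)) * (y ^ N * Q ^ N)
          ≈⟨ solve 4 (λ X y z s → z :+ (:- (X :* (:1 :- y))) :* (z :* s)
                               := z :- (:1 :- y) :* z :* (X :* s)) refl X y (y ^ N) (Q ^ N) ⟩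
        y ^ N - (1# - y) * y ^ N * (X * Q ^ N)
          ≈⟨ +-congˡ (-‿cong (*-congˡ (^-inverse N))) ⟩
        y ^ N - (1# - y) * y ^ N * 1#
          ≈⟨ solve 2 (λ y z → z :- (:1 :- y) :* z :* :1 := y :* z) refl y (y ^ N) ⟩
        y * y ^ N ∎
        where
        X X′ : Carrier
        X = Q⁻¹ ^ N
        X′ = Q⁻¹ ^ suc N
        X′Q≈X : X′ * Q ≈ X
        X′Q≈X = begin
          Q⁻¹ * X * Q    ≈⟨ solve 3 (λ r X Q → r :* X :* Q := X :* (r :* Q)) refl Q⁻¹ X Q ⟩
          X * (Q⁻¹ * Q)  ≈⟨ *-congˡ Q⁻¹-inverse ⟩
          X * 1#         ≈⟨ *-identityʳ X ⟩
          X              ∎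

    module _ {p} {S : Carrier → Set p} (S-isSubring : IsSubring R S)
             (Q∈ : S Q) (e∈ : ∀ k → S (e k))
             {x y X Y : Carrier} (x∈ : S x) (y∈ : S y) (X∈ : S X) (Y∈ : S Y)
             (xy≈XY : x * y ≈ X * Y) where

      open IsSubring S-isSubring

      factor∈ : ∀ {z} → S z → ∀ k → S (1# - z * Q ^ k)
      factor∈ z∈ k = +∈ 1∈ (-∈ (*∈ z∈ (^∈ Q∈ k)))

      poch∈ : ∀ {z} → S z → ∀ k → S (poch z k)
      poch∈ z∈ zero    = 1∈
      poch∈ z∈ (suc k) = *∈ (poch∈ z∈ k) (factor∈ z∈ k)

      factor-congruent : ∀ k → (1# - x * Q ^ k) * (1# - y * Q ^ k) ≈
                         (1# - X * Q ^ k) * (1# - Y * Q ^ k) + (X + Y - x - y) * Q ^ k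
      factor-congruent k = begin
        (1# - x * s) * (1# - y * s)
          ≈⟨ solve 3 (λ x y s → (:1 :- x :* s) :* (:1 :- y :* s)
                             := :1 :- (x :+ y) :* s :+ x :* y :* (s :* s)) refl x y s ⟩
        1# - (x + y) * s + x * y * (s * s)
          ≈⟨ +-congˡ (*-congʳ xy≈XY) ⟩
        1# - (x + y) * s + X * Y * (s * s)
          ≈⟨ solve 5 (λ x y X Y s → :1 :- (x :+ y) :* s :+ X :* Y :* (s :* s)
                := (:1 :- X :* s) :* (:1 :- Y :* s) :+ (X :+ Y :- x :- y) :* s) refl x y X Y s ⟩
        (1# - X * s) * (1# - Y * s) + (X + Y - x - y) * s ∎
        where s = Q ^ k

      -- Only the product of the two shifted factorials is congruent, factor pair by factor pair;
      -- neither factorial is congruent to its counterpart separately in general.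
      poch-congruent : ∀ k → ∃[ g ] S g ×
                       poch x k * poch y k ≈ poch X k * poch Y k + (X + Y - x - y) * g
      poch-congruent zero    = 0# , 0∈ , solve 1 (λ u → :1 :* :1 := :1 :* :1 :+ u :* :0) refl _
      poch-congruent (suc k) with poch-congruent k
      ... | g , g∈ , e =
        -- Product rule for differences: the old difference times the new factors at x, y, plus the
        -- old products at X, Y times the new difference.
        g * (f x * f y) + poch X k * poch Y k * Q ^ k ,
        +∈ (*∈ g∈ (*∈ (factor∈ x∈ k) (factor∈ y∈ k))) (*∈ (*∈ (poch∈ X∈ k) (poch∈ Y∈ k)) (^∈ Q∈ k)) ,
        (begin
        poch x k * f x * (poch y k * f y)
          ≈⟨ solve 4 (λ p f r g → p :* f :* (r :* g) := p :* r :* (f :* g)) refl _ _ _ _ ⟩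
        poch x k * poch y k * (f x * f y)
          ≈⟨ *-congʳ e ⟩
        (poch X k * poch Y k + u * g) * (f x * f y)
          ≈⟨ distribʳ _ _ _ ⟩
        poch X k * poch Y k * (f x * f y) + u * g * (f x * f y)
          ≈⟨ +-congʳ (*-congˡ (factor-congruent k)) ⟩
        poch X k * poch Y k * (f X * f Y + u * Q ^ k) + u * g * (f x * f y)
          ≈⟨ solve 8 (λ P P′ F F′ u s g h →
                P :* P′ :* (F :* F′ :+ u :* s) :+ u :* g :* h
                := P :* F :* (P′ :* F′) :+ u :* (g :* h :+ P :* P′ :* s))
                refl (poch X k) (poch Y k) (f X) (f Y) u (Q ^ k) g (f x * f y) ⟩
        poch X k * f X * (poch Y k * f Y) + u * (g * (f x * f y) + poch X k * poch Y k * Q ^ k) ∎)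
        where
        u : Carrier
        u = X + Y - x - y
        f : Carrier → Carrier
        f z = 1# - z * Q ^ k

      term-congruent : ∀ k → ∃[ g ] S g × term x y k ≈ term X Y k + (X + Y - x - y) * g
      term-congruent k with poch-congruent k
      ... | g , g∈ , eq = g * Q ^ k * e k , *∈ (*∈ g∈ (^∈ Q∈ k)) (e∈ k) ,
        trans (*-congʳ (*-congʳ eq))
          (solve 6 (λ P P′ u g s e → (P :* P′ :+ u :* g) :* s :* e
                                  := P :* P′ :* s :* e :+ u :* (g :* s :* e)) refl _ _ _ g _ _)

      sum∈ : ∀ {m} (f : Fin m → Carrier) → (∀ i → S (f i)) → S (sum f)
      sum∈ {zero}  f f∈ = 0∈
      sum∈ {suc m} f f∈ = +∈ (f∈ fzero) (sum∈ (λ i → f (fsuc i)) (λ i → f∈ (fsuc i)))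

      series-congruent : ∀ m → ∃[ g ] S g × series m x y ≈ series m X Y + (X + Y - x - y) * g
      series-congruent m =
        sum {m} (λ i → proj₁ (term-congruent (toℕ i))) ,
        sum∈ {m} _ (λ i → proj₁ (proj₂ (term-congruent (toℕ i)))) ,
        sum-linear {m} _ _ _ _ (λ i → proj₂ (proj₂ (term-congruent (toℕ i))))

-- The fractions of a domain form a commutative ring.

module FractionRing (R : DecidableDomain c ℓ) where

  open DecidableDomain R
  open FractionField R
  open DifferenceSolver commutativeRing
  open RingProperties ring using ([y-z]x≈yx-zx)
  open AbelianGroupProperties +-abelianGroup using (x∙y⁻¹≈ε⇒x≈y; x≈y⇒x∙y⁻¹≈ε)
  open SetoidReasoning setoid

  *-cancelʳ-≉0 : ∀ {x y z} → z ≉ 0# → x * z ≈ y * z → x ≈ y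
  *-cancelʳ-≉0 {x} {y} {z} z≉0 xz≈yz =
    [ x∙y⁻¹≈ε⇒x≈y x y , (λ z≈0 → contradiction z≈0 z≉0) ]′
      (*-zeroProduct (x - y) z (trans ([y-z]x≈yx-zx z x y) (x≈y⇒x∙y⁻¹≈ε xz≈yz)))

  -- Chaining the two cross products leaves the middle denominator as a common factor; it is
  -- nonzero, so it cancels in a domain.
  ≃-trans : ∀ {x y z} → x ≃ y → y ≃ z → x ≃ z
  ≃-trans {fraction m d _} {fraction n e e≉0} {fraction p f _} (mk≃ me≈nd) (mk≃ nf≈pe) =
    mk≃ (*-cancelʳ-≉0 e≉0 (begin
      m * f * e   ≈⟨ solve 3 (λ m f e → m :* f :* e := m :* e :* f) refl m f e ⟩
      m * e * f   ≈⟨ *-congʳ me≈nd ⟩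
      n * d * f   ≈⟨ solve 3 (λ n d f → n :* d :* f := n :* f :* d) refl n d f ⟩
      n * f * d   ≈⟨ *-congʳ nf≈pe ⟩
      p * e * d   ≈⟨ solve 3 (λ p e d → p :* e :* d := p :* d :* e) refl p e d ⟩
      p * d * e   ∎))

  addF-cong : ∀ {x x′ y y′} → x ≃ x′ → y ≃ y′ → addF x y ≃ addF x′ y′
  addF-cong {fraction m d _} {fraction m′ d′ _} {fraction n e _} {fraction n′ e′ _} (mk≃ p) (mk≃ r) = mk≃ (begin
    (m * e + n * d) * (d′ * e′)
      ≈⟨ solve 6 (λ m d n e d′ e′ → (m :* e :+ n :* d) :* (d′ :* e′)
                    := m :* d′ :* (e :* e′) :+ n :* e′ :* (d :* d′)) refl m d n e d′ e′ ⟩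
    m * d′ * (e * e′) + n * e′ * (d * d′)
      ≈⟨ +-cong (*-congʳ p) (*-congʳ r) ⟩
    m′ * d * (e * e′) + n′ * e * (d * d′)
      ≈⟨ solve 6 (λ m′ d n′ e d′ e′ → m′ :* d :* (e :* e′) :+ n′ :* e :* (d :* d′)
                    := (m′ :* e′ :+ n′ :* d′) :* (d :* e)) refl m′ d n′ e d′ e′ ⟩
    (m′ * e′ + n′ * d′) * (d * e) ∎)

  mulF-cong : ∀ {x x′ y y′} → x ≃ x′ → y ≃ y′ → mulF x y ≃ mulF x′ y′
  mulF-cong {fraction m d _} {fraction m′ d′ _} {fraction n e _} {fraction n′ e′ _} (mk≃ p) (mk≃ r) = mk≃ (begin
    m * n * (d′ * e′)     ≈⟨ solve 4 (λ m n d′ e′ → m :* n :* (d′ :* e′) := m :* d′ :* (n :* e′)) refl m n d′ e′ ⟩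
    m * d′ * (n * e′)     ≈⟨ *-cong p r ⟩
    m′ * d * (n′ * e)     ≈⟨ solve 4 (λ m d n e → m :* d :* (n :* e) := m :* n :* (d :* e)) refl m′ d n′ e ⟩
    m′ * n′ * (d * e)     ∎)

  negF-cong : ∀ {x y} → x ≃ y → negF x ≃ negF y
  negF-cong {fraction m d _} {fraction n e _} (mk≃ p) = mk≃ (begin
    - m * e    ≈⟨ solve 2 (λ m e → :- m :* e := :- (m :* e)) refl m e ⟩
    - (m * e)  ≈⟨ -‿cong p ⟩
    - (n * d)  ≈⟨ solve 2 (λ n d → :- (n :* d) := :- n :* d) refl n d ⟩
    - n * d    ∎)

  addF-comm : ∀ x y → addF x y ≃ addF y x
  addF-comm (fraction m d _) (fraction n e _) = mk≃
    (solve 4 (λ m d n e → (m :* e :+ n :* d) :* (e :* d) := (n :* d :+ m :* e) :* (d :* e)) refl m d n e)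

  mulF-comm : ∀ x y → mulF x y ≃ mulF y x
  mulF-comm (fraction m d _) (fraction n e _) = mk≃
    (solve 4 (λ m d n e → m :* n :* (e :* d) := n :* m :* (d :* e)) refl m d n e)

  addF-identityˡ : ∀ x → addF (embed 0#) x ≃ x
  addF-identityˡ (fraction m d _) = mk≃
    (solve 2 (λ m d → (:0 :* d :+ m :* :1) :* d := m :* (:1 :* d)) refl m d)

  mulF-identityˡ : ∀ x → mulF (embed 1#) x ≃ x
  mulF-identityˡ (fraction m d _) = mk≃
    (solve 2 (λ m d → :1 :* m :* d := m :* (:1 :* d)) refl m d)

  negF-inverseˡ : ∀ x → addF (negF x) x ≃ embed 0#
  negF-inverseˡ (fraction m d _) = mk≃
    (solve 2 (λ m d → (:- m :* d :+ m :* d) :* :1 := :0 :* (d :* d)) refl m d)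

  mulF-distribˡ : ∀ x y z → mulF x (addF y z) ≃ addF (mulF x y) (mulF x z)
  mulF-distribˡ (fraction m d _) (fraction n e _) (fraction p f _) = mk≃
    (solve 6 (λ m d n e p f →
        m :* (n :* f :+ p :* e) :* (d :* e :* (d :* f))
        := (m :* n :* (d :* f) :+ m :* p :* (d :* e)) :* (d :* (e :* f))) refl m d n e p f)

  addF-assoc : ∀ x y z → addF (addF x y) z ≃ addF x (addF y z)
  addF-assoc (fraction m d _) (fraction n e _) (fraction p f _) = mk≃
    (solve 6 (λ m d n e p f →
        ((m :* e :+ n :* d) :* f :+ p :* (d :* e)) :* (d :* (e :* f))
        := (m :* (e :* f) :+ (n :* f :+ p :* e) :* d) :* (d :* e :* f)) refl m d n e p f)

  mulF-assoc : ∀ x y z → mulF (mulF x y) z ≃ mulF x (mulF y z)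
  mulF-assoc (fraction m d _) (fraction n e _) (fraction p f _) = mk≃
    (solve 6 (λ m d n e p f → m :* n :* p :* (d :* (e :* f)) := m :* (n :* p) :* (d :* e :* f)) refl m d n e p f)

  fractionRing : CommutativeRing _ _
  fractionRing = record
    { Carrier = Fraction
    ; _≈_ = _≃_
    ; _+_ = addF
    ; _*_ = mulF
    ; -_  = negF
    ; 0#  = embed 0#
    ; 1#  = embed 1#
    ; isCommutativeRing = record
      { isRing = record
        { +-isAbelianGroup = record
          { isGroup = record
            { isMonoid = record
              { isSemigroup = record
                { isMagma = record
                  { isEquivalence = record
                    { refl  = mk≃ refl
                    ; sym   = λ { (mk≃ p) → mk≃ (sym p) }
                    ; trans = ≃-trans
                    }
                  ; ∙-cong = addF-cong
                  }
                ; assoc = addF-assoc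
                }
              ; identity = addF-identityˡ , λ x → ≃-trans (addF-comm x (embed 0#)) (addF-identityˡ x)
              }
            ; inverse = negF-inverseˡ , λ x → ≃-trans (addF-comm x (negF x)) (negF-inverseˡ x)
            ; ⁻¹-cong = negF-cong
            }
          ; comm = addF-comm
          }
        ; *-cong = mulF-cong
        ; *-assoc = mulF-assoc
        ; *-identity = mulF-identityˡ , λ x → ≃-trans (mulF-comm x (embed 1#)) (mulF-identityˡ x)
        ; distrib = mulF-distribˡ , λ x y z →
            ≃-trans (mulF-comm (addF y z) x)
              (≃-trans (mulF-distribˡ x y z) (addF-cong (mulF-comm x y) (mulF-comm x z)))
        }
      ; *-comm = mulF-comm
      }
    }

  embed-cong : ∀ {x y} → x ≈ y → embed x ≃ embed y
  embed-cong x≈y = mk≃ (*-congʳ x≈y)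

  embed-+ : ∀ x y → embed (x + y) ≃ addF (embed x) (embed y)
  embed-+ x y = mk≃ (solve 2 (λ x y → (x :+ y) :* (:1 :* :1) := (x :* :1 :+ y :* :1) :* :1) refl x y)

  embed-* : ∀ x y → embed (x * y) ≃ mulF (embed x) (embed y)
  embed-* x y = mk≃ (solve 2 (λ x y → x :* y :* (:1 :* :1) := x :* y :* :1) refl x y)

  open RawSemiringDefinitions (RawRing.rawSemiring rawRing) using (_^_)
  open RawSemiringDefinitions (RawRing.rawSemiring fractionRawRing) using () renaming (_^_ to _^F_)

  embed-^ : ∀ x k → embed (x ^ k) ≃ embed x ^F k
  embed-^ x zero    = mk≃ refl
  embed-^ x (suc k) = ≃-trans (embed-* x (x ^ k)) (mulF-cong {embed x} {embed x} (mk≃ refl) (embed-^ x k))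

  invF-inverseʳ : ∀ {x p} → p ≉ 0# → x ≃ embed p → mulF x (invF x) ≃ embed 1#
  invF-inverseʳ {fraction m d d≉0} {p} p≉0 (mk≃ e) with m ≟ 0#
  ... | no  _   = mk≃ (solve 2 (λ m d → m :* d :* :1 := :1 :* (d :* m)) refl m d)
  -- The junk branch of `invF` is unreachable: a zero numerator would force p · d = 0 with both
  -- factors nonzero.
  ... | yes m≈0 = contradiction
    (trans (sym e) (trans (*-congʳ m≈0) (zeroˡ 1#))) (*-≉0 p≉0 d≉0)

  -- Passes from a cleared equation to the literal quotient C/D that the definition of congruence
  -- demands.
  ≃-fraction : ∀ {x C D} (D≉0 : D ≉ 0#) → mulF x (embed D) ≃ embed C → x ≃ fraction C D D≉0
  ≃-fraction {fraction m d _} {C} {D} D≉0 (mk≃ e) = mk≃ (begin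
    m * D           ≈⟨ *-identityʳ _ ⟨
    m * D * 1#      ≈⟨ e ⟩
    C * (d * 1#)    ≈⟨ *-congˡ (*-identityʳ d) ⟩
    C * d           ∎)

-- Divisibility and coprimality in R[X].

module PolynomialDivisibility (R : DecidableDomain c ℓ) where

  open DecidableDomain R
  open Polynomial commutativeRing
  open RawSemiringDefinitions (RawRing.rawSemiring rawRing) using () renaming (_∣_ to _∣ᵣ_)
  private
    module P = DecidableDomain (polynomialDomain R)
  open RawSemiringDefinitions (RawRing.rawSemiring P.rawRing) using (Coprime)
    renaming (_∣_ to _∣ₚ_; _^_ to _^ₚ_)
  open SetoidReasoning setoid

  constant-⊗ : ∀ x y → constant (x * y) ≋ constant x ⊗ constant y
  constant-⊗ x y = ∷-cong (sym (+-identityʳ _)) (≋-refl {[]})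

  constant-≉0 : ∀ {x} → x ≉ 0# → P._≉_ (constant x) P.0#
  constant-≉0 x≉0 e = x≉0 (coeff≈ e 0)

  X-⊗ : ∀ p → X ⊗ p ≋ 0# ∷ p
  X-⊗ p = ≋-trans (0∷-⊗ (1# ∷ []) p refl) (∷-cong refl (⊗-identityˡ p))

  coeff₀-⊗ : ∀ p r → coeff (p ⊗ r) 0 ≈ coeff p 0 * coeff r 0
  coeff₀-⊗ []      r = sym (zeroˡ _)
  coeff₀-⊗ (x ∷ p) r = begin
    coeff (scale x r ⊕ (0# ∷ p ⊗ r)) 0  ≈⟨ coeff-⊕ (scale x r) _ 0 ⟩
    coeff (scale x r) 0 + 0#            ≈⟨ +-identityʳ _ ⟩
    coeff (scale x r) 0                 ≈⟨ coeff-scale x r 0 ⟩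
    x * coeff r 0                       ∎

  coeff-⊗-constant : ∀ p x i → coeff (p ⊗ constant x) i ≈ coeff p i * x
  coeff-⊗-constant p x i = begin
    coeff (p ⊗ constant x) i                ≈⟨ coeff≈ (⊗-comm p (constant x)) i ⟩
    coeff (scale x p ⊕ (0# ∷ [])) i         ≈⟨ coeff≈ (⊕-cong (≋-refl {scale x p}) (0∷[]≋[] refl)) i ⟩
    coeff (scale x p ⊕ []) i                ≈⟨ coeff≈ (⊕-identityʳ (scale x p)) i ⟩
    coeff (scale x p) i                     ≈⟨ coeff-scale x p i ⟩
    x * coeff p i                           ≈⟨ *-comm _ _ ⟩
    coeff p i * x                           ∎

  tail : List Carrier → List Carrier
  tail []      = []
  tail (x ∷ p) = p

  0∷tail : ∀ p → coeff p 0 ≈ 0# → p ≋ 0# ∷ tail p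
  0∷tail []      e = ≋-sym (0∷[]≋[] refl)
  0∷tail (x ∷ p) e = ∷-cong e ≋-refl

  -- Comparing constant terms in w z = X(...) shows that w has constant term 0, since z does not; so
  -- X can be removed from the cofactor w, one power at a time.
  ∣-X^-cancel : ∀ m {z r} → coeff z 0 ≉ 0# → z ∣ₚ X ^ₚ m ⊗ r → z ∣ₚ r
  ∣-X^-cancel zero    {z} {r} z₀≉0 (w ∣, wz≋r) = w ∣, ≋-trans wz≋r (⊗-identityˡ r)
  ∣-X^-cancel (suc m) {z} {r} z₀≉0 (w ∣, wz≋) = ∣-X^-cancel m z₀≉0 (tail w ∣, mk≋ λ i → coeff≈ shifted (suc i))
    where
    shift : w ⊗ z ≋ 0# ∷ X ^ₚ m ⊗ r
    shift = ≋-trans wz≋ (≋-trans (⊗-assoc X (X ^ₚ m) r) (X-⊗ _))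
    w₀≈0 : coeff w 0 ≈ 0#
    w₀≈0 = [ (λ e → e) , (λ z₀≈0 → contradiction z₀≈0 z₀≉0) ]′
      (*-zeroProduct _ _ (trans (sym (coeff₀-⊗ w z)) (coeff≈ shift 0)))
    shifted : 0# ∷ tail w ⊗ z ≋ 0# ∷ X ^ₚ m ⊗ r
    shifted = ≋-trans (≋-sym (0∷-⊗ (tail w) z refl)) (≋-trans (⊗-cong (≋-sym (0∷tail w w₀≈0)) ≋-refl) shift)

  -- A bound on coefficients rather than on the length of the list, because trailing zeros are
  -- allowed.
  DegreeBound : List Carrier → ℕ → Set ℓ
  DegreeBound p n = ∀ i → n ℕ.< i → coeff p i ≈ 0#

  coeff-⊗-top : ∀ p r m n → DegreeBound p m → DegreeBound r n →
                coeff (p ⊗ r) (m ℕ.+ n) ≈ coeff p m * coeff r n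
  coeff-⊗-top []      r m       n p≤ r≤ = sym (zeroˡ _)
  coeff-⊗-top (x ∷ p) r zero    n p≤ r≤ = begin
    coeff (scale x r ⊕ (0# ∷ p ⊗ r)) n
      ≈⟨ coeff≈ (⊕-cong (≋-refl {scale x r}) (≋-trans (∷-cong refl (⊗-cong {p} {[]} {r} {r} p≋[] ≋-refl)) (0∷[]≋[] refl))) n ⟩
    coeff (scale x r ⊕ []) n      ≈⟨ coeff≈ (⊕-identityʳ (scale x r)) n ⟩
    coeff (scale x r) n           ≈⟨ coeff-scale x r n ⟩
    x * coeff r n                 ∎
    where
    p≋[] : p ≋ []
    p≋[] = mk≋ λ i → p≤ (suc i) (s≤s z≤n)
  coeff-⊗-top (x ∷ p) r (suc m) n p≤ r≤ = begin
    coeff (scale x r ⊕ (0# ∷ p ⊗ r)) (suc (m ℕ.+ n))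
      ≈⟨ coeff-⊕ (scale x r) _ (suc (m ℕ.+ n)) ⟩
    coeff (scale x r) (suc (m ℕ.+ n)) + coeff (p ⊗ r) (m ℕ.+ n)
      ≈⟨ +-cong (trans (coeff-scale x r _) (trans (*-congˡ (r≤ _ (s≤s (ℕ.m≤n+m n m)))) (zeroʳ x)))
           (coeff-⊗-top p r m n (λ i m<i → p≤ (suc i) (s≤s m<i)) r≤) ⟩
    0# + coeff p m * coeff r n      ≈⟨ +-identityˡ _ ⟩
    coeff p m * coeff r n           ∎

  leading : ∀ p → p ≋ [] ⊎ ∃[ n ] coeff p n ≉ 0# × DegreeBound p n
  leading []      = inj₁ ≋-refl
  leading (x ∷ p) with leading p | x ≟ 0#
  ... | inj₂ (n , pₙ≉0 , p≤) | _       = inj₂ (suc n , pₙ≉0 , λ { (suc i) (s≤s n<i) → p≤ i n<i })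
  ... | inj₁ p≋[]            | yes x≈0 = inj₁ (≋-trans (∷-cong x≈0 p≋[]) (0∷[]≋[] refl))
  ... | inj₁ p≋[]            | no  x≉0 = inj₂ (0 , x≉0 , λ { (suc i) _ → coeff≈ p≋[] i })

  -- Degrees add in a domain: if z had positive degree, the product of the leading coefficients of w
  -- and z would be a nonzero coefficient of `constant d` at a positive index.
  ∣-constant : ∀ {z d} → d ≉ 0# → z ∣ₚ constant d → z ≋ constant (coeff z 0)
  ∣-constant {z} {d} d≉0 (w ∣, wz≋d) with leading w | leading z
  ... | inj₁ w≋[] | _ = contradiction
    (coeff≈ (≋-trans (≋-sym wz≋d) (⊗-cong {w} {[]} {z} {z} w≋[] ≋-refl)) 0) d≉0
  ... | inj₂ _ | inj₁ z≋[] = mk≋ λ { zero → refl ; (suc i) → coeff≈ z≋[] (suc i) }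
  ... | inj₂ _ | inj₂ (zero , _ , z≤) = mk≋ λ { zero → refl ; (suc i) → z≤ (suc i) (s≤s z≤n) }
  ... | inj₂ (m , wₘ≉0 , w≤) | inj₂ (suc n , zₙ≉0 , z≤) = contradiction top≈0 (*-≉0 wₘ≉0 zₙ≉0)
    where
    open FractionField R using (*-≉0)
    top≈0 : coeff w m * coeff z (suc n) ≈ 0#
    top≈0 = trans (sym (coeff-⊗-top w z m (suc n) w≤ z≤))
      (trans (coeff≈ wz≋d (m ℕ.+ suc n)) (reflexive (≡.cong (coeff (constant d)) (ℕ.+-suc m n))))

  -- A common divisor has nonzero constant term, so it divides d, hence is a
  -- constant dividing every coefficient of r.
  coprime-X^-constant : ∀ m {d r} → d ≉ 0# → coeff r 0 ≉ 0# →
                        (∀ e → (∀ i → e ∣ᵣ coeff r i) → e ∣ᵣ 1#) →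
                        Coprime (X ^ₚ m ⊗ constant d) r
  coprime-X^-constant m {d} {r} d≉0 r₀≉0 content∣1 {z} z∣D (v ∣, vz≋r) =
    constant f ∣, ≋-trans (⊗-congˡ (constant f) z≋z₀) (≋-trans (≋-sym (constant-⊗ f (coeff z 0))) (∷-cong fz₀≈1 ≋-refl))
    where
    z₀≉0 : coeff z 0 ≉ 0#
    z₀≉0 z₀≈0 = r₀≉0 (begin
      coeff r 0              ≈⟨ coeff≈ vz≋r 0 ⟨
      coeff (v ⊗ z) 0        ≈⟨ coeff₀-⊗ v z ⟩
      coeff v 0 * coeff z 0  ≈⟨ *-congˡ z₀≈0 ⟩
      coeff v 0 * 0#         ≈⟨ zeroʳ _ ⟩
      0#                     ∎)
    z≋z₀ : z ≋ constant (coeff z 0)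
    z≋z₀ = ∣-constant d≉0 (∣-X^-cancel m z₀≉0 z∣D)
    z₀∣1 : coeff z 0 ∣ᵣ 1#
    z₀∣1 = content∣1 (coeff z 0) λ i → coeff v i ∣, (begin
      coeff v i * coeff z 0                ≈⟨ coeff-⊗-constant v (coeff z 0) i ⟨
      coeff (v ⊗ constant (coeff z 0)) i   ≈⟨ coeff≈ (⊗-congˡ v z≋z₀) i ⟨
      coeff (v ⊗ z) i                      ≈⟨ coeff≈ vz≋r i ⟩
      coeff r i                            ∎)
    f : Carrier
    f = let (g ∣, _) = z₀∣1 in g
    fz₀≈1 : f * coeff z 0 ≈ 1#
    fz₀≈1 = let (_ ∣, g) = z₀∣1 in g

  -- The coefficients r₀ = s and r₁ = 1 - ts satisfy r₁ + t r₀ = 1, so they already generate the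
  -- unit ideal and the quadratic is primitive.
  coprime-quadratic : ∀ m {d t s} → d ≉ 0# → s ≉ 0# →
                      Coprime (X ^ₚ m ⊗ constant d) ((constant 1# ⊕ ⊖ (X ⊗ constant t)) ⊗ (X ⊕ constant s))
  coprime-quadratic m {d} {t} {s} d≉0 s≉0 = coprime-X^-constant m d≉0
    (λ r₀≈0 → s≉0 (trans (sym r₀≈s) r₀≈0))
    λ e e∣r → let (f ∣, fe≈r₀) = e∣r 0
                  (g ∣, ge≈r₁) = e∣r 1
              in g + t * f ∣, (begin
      (g + t * f) * e       ≈⟨ solve 4 (λ g t f e → (g :+ t :* f) :* e := g :* e :+ t :* (f :* e)) refl g t f e ⟩
      g * e + t * (f * e)   ≈⟨ +-cong (trans ge≈r₁ r₁≈) (*-congˡ (trans fe≈r₀ r₀≈s)) ⟩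
      1# - t * s + t * s    ≈⟨ solve 1 (λ x → :1 :- x :+ x := :1) refl (t * s) ⟩
      1#                    ∎)
    where
    open DifferenceSolver commutativeRing
    r : List Carrier
    r = (constant 1# ⊕ ⊖ (X ⊗ constant t)) ⊗ (X ⊕ constant s)
    left : constant 1# ⊕ ⊖ (X ⊗ constant t) ≋ 1# ∷ - t ∷ []
    left = ≋-trans (⊕-cong (≋-refl {constant 1#}) (⊖-cong (X-⊗ (constant t))))
      (∷-cong (solve 0 (:1 :- :0 := :1) refl) ≋-refl)
    right : X ⊕ constant s ≋ s ∷ 1# ∷ []
    right = ∷-cong (+-identityˡ s) ≋-refl
    expand : r ≋ (1# ∷ - t ∷ []) ⊗ (s ∷ 1# ∷ [])
    expand = ⊗-cong left right
    r₀≈s : coeff r 0 ≈ s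
    r₀≈s = trans (coeff≈ expand 0) (solve 1 (λ s → :1 :* s :+ :0 := s) refl s)
    r₁≈ : coeff r 1 ≈ 1# - t * s
    r₁≈ = trans (coeff≈ expand 1)
      (solve 2 (λ t s → :1 :* :1 :+ (:- t :* s :+ :0) := :1 :- t :* s) refl t s)

-- The admissible denominators.

-- Denominators aᵐ d(q): they are coprime to the modulus, and allowing them all
-- makes a, q and (q²;q²)ₖ invertible.
module MonomialDenominators (R : DecidableDomain c ℓ) where

  private
    module R = DecidableDomain R
    module A = DecidableDomain (polynomialDomain R)
    module RE = Exponentiation R.commutativeSemiring
  open Polynomial R.commutativeRing using (X; constant; coeff≈)
  open PolynomialDivisibility R
  open RawSemiringDefinitions
    (RawRing.rawSemiring (CommutativeRing.rawRing (DecidableDomain.commutativeRing (polynomialDomain R))))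
    using (Coprime) renaming (_^_ to _^ₚ_)
  open Exponentiation A.commutativeSemiring using (^-homo-*)
  open CommutativeSemigroupProperties A.*-commutativeSemigroup using (interchange)
  open FractionField (polynomialDomain R) using () renaming (*-≉0 to ⊗-≉0)
  open FractionField R using (*-≉0)

  Monomial : A.Carrier → Set _
  Monomial D = ∃[ m ] ∃[ d ] R._≉_ d R.0# × D A.≈ X ^ₚ m A.* constant d

  monomial-* : ∀ {D E} → Monomial D → Monomial E → Monomial (D A.* E)
  monomial-* (m , d , d≉0 , D≈) (n , e , e≉0 , E≈) =
    m ℕ.+ n , d R.* e , *-≉0 d≉0 e≉0 ,
    A.trans (A.*-cong D≈ E≈) (A.trans
      (interchange (X ^ₚ m) (constant d) (X ^ₚ n) (constant e))
      (A.sym (A.*-cong (^-homo-* X m n) (constant-⊗ d e))))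

  monomial-constant : ∀ {D d} → R._≉_ d R.0# → D A.≈ constant d → Monomial D
  monomial-constant {d = d} d≉0 D≈ = 0 , d , d≉0 , A.trans D≈ (A.sym (A.*-identityˡ (constant d)))

  monomial-1 : Monomial A.1#
  monomial-1 = monomial-constant R.1≉0 A.refl

  monomial-X : Monomial X
  monomial-X = 1 , R.1# , R.1≉0 , A.sym (A.trans (A.*-identityʳ _) (A.*-identityʳ X))

  monomial-≉0 : ∀ {D} → Monomial D → A._≉_ D A.0#
  monomial-≉0 (m , d , d≉0 , D≈) D≈0 = ⊗-≉0 (X^≉0 m) (constant-≉0 d≉0) (A.trans (A.sym D≈) D≈0)
    where
    X^≉0 : ∀ m → A._≉_ (X ^ₚ m) A.0#
    X^≉0 zero    = A.1≉0
    X^≉0 (suc m) = ⊗-≉0 {X} {X ^ₚ m} (λ e → R.1≉0 (coeff≈ e 1)) (X^≉0 m)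

  constant-^ : ∀ t k → constant t ^ₚ k A.≈ constant (t RE.^ k)
  constant-^ t zero    = A.refl
  constant-^ t (suc k) = A.trans (A.*-congˡ {constant t} (constant-^ t k)) (A.sym (constant-⊗ t (t RE.^ k)))

  module _ {t : R.Carrier} (t≉0 : R._≉_ t R.0#) where

    monomial-q : Monomial (constant t)
    monomial-q = monomial-constant t≉0 A.refl

    monomial-1-q^ : (∀ k → R._≉_ (t RE.^ suc k) R.1#) → ∀ k → Monomial (A.1# A.- constant t ^ₚ suc k)
    monomial-1-q^ t^≉1 k = monomial-constant {d = R.1# R.- t RE.^ suc k}
      (λ e → t^≉1 k (R.sym (x∙y⁻¹≈ε⇒x≈y R.1# (t RE.^ suc k) e)))
      (A.+-congˡ {A.1#} (A.-‿cong (constant-^ t (suc k))))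
      where open AbelianGroupProperties R.+-abelianGroup using (x∙y⁻¹≈ε⇒x≈y)

    private
      t^≉0 : ∀ k → R._≉_ (t RE.^ k) R.0#
      t^≉0 zero    = R.1≉0
      t^≉0 (suc k) = *-≉0 t≉0 (t^≉0 k)

    -- Letting `r` be anything equal to a nonzero constant covers both second factors, a + qⁿ and a
    -- - qⁿ.
    coprime-modulus : ∀ {s D} n → R._≉_ s R.0# → ∀ {r} → r A.≈ constant s → Monomial D →
                      Coprime D ((A.1# A.- X A.* constant t ^ₚ n) A.* (X A.+ r))
    coprime-modulus {s} n s≉0 {r} r≈s (m , d , d≉0 , D≈) (w ∣, wz≈D) (v ∣, vz≈P) =
      coprime-quadratic m {t = t RE.^ n} d≉0 s≉0 (w ∣, A.trans wz≈D D≈) (v ∣, A.trans vz≈P (A.*-cong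
        (A.+-congˡ {A.1#} (A.-‿cong (A.*-congˡ {X} (constant-^ t n))))
        (A.+-congˡ {X} r≈s)))

    coprime-plus : ∀ n {D} → Monomial D → Coprime D ((A.1# A.- X A.* constant t ^ₚ n) A.* (X A.+ constant t ^ₚ n))
    coprime-plus n = coprime-modulus n (t^≉0 n) (constant-^ t n)

    coprime-minus : ∀ n {D} → Monomial D → Coprime D ((A.1# A.- X A.* constant t ^ₚ n) A.* (X A.- constant t ^ₚ n))
    coprime-minus n = coprime-modulus n
      (λ e → t^≉0 n (R.trans (R.sym (-‿involutive _)) (R.trans (R.-‿cong e) -0#≈0#)))
      (A.-‿cong (constant-^ t n))
      where open RingProperties R.ring using (-‿involutive; -0#≈0#)

-- Sums, products and negatives with denominators cleared.

module ClearingDenominators (K : CommutativeRing c ℓ) where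

  open CommutativeRing K
  open DifferenceSolver K

  clear-+ : ∀ x y d e {m n} → x * d ≈ m → y * e ≈ n → (x + y) * (d * e) ≈ m * e + n * d
  clear-+ x y d e xd≈m ye≈n = trans
    (solve 4 (λ x y d e → (x :+ y) :* (d :* e) := x :* d :* e :+ y :* e :* d) refl x y d e)
    (+-cong (*-congʳ xd≈m) (*-congʳ ye≈n))

  clear-* : ∀ x y d e {m n} → x * d ≈ m → y * e ≈ n → x * y * (d * e) ≈ m * n
  clear-* x y d e xd≈m ye≈n = trans
    (solve 4 (λ x y d e → x :* y :* (d :* e) := x :* d :* (y :* e)) refl x y d e)
    (*-cong xd≈m ye≈n)

  clear-neg : ∀ x d {m} → x * d ≈ m → - x * d ≈ - m
  clear-neg x d xd≈m = trans
    (solve 2 (λ x d → :- x :* d := :- (x :* d)) refl x d) (-‿cong xd≈m)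

-- The congruence over an abstract commutative ring.

module SeriesCongruence (K : CommutativeRing c ℓ) where

  open CommutativeRing K
  open Exponentiation commutativeSemiring

  module _ {p} {S : Carrier → Set p} (S-isSubring : IsSubring K S)
           {a a⁻¹ q q⁻¹ : Carrier} (a∈ : S a) (a⁻¹∈ : S a⁻¹) (q∈ : S q) (q⁻¹∈ : S q⁻¹)
           (a-inverse : a * a⁻¹ ≈ 1#) (q-inverse : q * q⁻¹ ≈ 1#) where

    open QSeries K (q ^ 2)

    module _ (e : ℕ → Carrier) (e-inverse : ∀ k → poch (q ^ 2) k * e k ≈ 1#) (e∈ : ∀ k → S (e k))
             (N : ℕ) {y η : Carrier} (y∈ : S y) (η∈ : S η) (ya≈ηq : y * a ≈ η * q) where

      open IsSubring S-isSubring
      open DifferenceSolver K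
      open SetoidReasoning setoid

      private
        n : ℕ
        n = 1 ℕ.+ 2 ℕ.* N

        Q Q⁻¹ x X Y u : Carrier
        Q   = q ^ 2
        Q⁻¹ = q⁻¹ ^ 2
        x   = a * q
        X   = Q⁻¹ ^ N
        Y   = η * Q ^ suc N
        u   = X + Y - x - y

        Q⁻¹-inverse : Q⁻¹ * Q ≈ 1#
        Q⁻¹-inverse = begin
          Q⁻¹ * Q
            ≈⟨ solve 2 (λ r q → r :* (r :* :1) :* (q :* (q :* :1)) := q :* r :* (q :* r)) refl q⁻¹ q ⟩
          q * q⁻¹ * (q * q⁻¹)  ≈⟨ *-cong q-inverse q-inverse ⟩
          1# * 1#              ≈⟨ *-identityˡ 1# ⟩
          1#                   ∎

        Q^≈q^ : ∀ k → Q ^ k ≈ q ^ (2 ℕ.* k)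
        Q^≈q^ k = ^-assocʳ q 2 k

        X-inverse : X * Q ^ N ≈ 1#
        X-inverse = ^-inverse e e-inverse Q⁻¹ Q⁻¹-inverse N

        xy≈XY : x * y ≈ X * Y
        xy≈XY = begin
          a * q * y              ≈⟨ solve 3 (λ a q y → a :* q :* y := q :* (y :* a)) refl a q y ⟩
          q * (y * a)            ≈⟨ *-congˡ ya≈ηq ⟩
          q * (η * q)            ≈⟨ solve 2 (λ q h → q :* (h :* q) := h :* (q :* (q :* :1)) :* :1) refl q η ⟩
          η * Q * 1#             ≈⟨ *-congˡ X-inverse ⟨
          η * Q * (X * Q ^ N)
            ≈⟨ solve 4 (λ h Q X s → h :* Q :* (X :* s) := X :* (h :* (Q :* s))) refl η Q X (Q ^ N) ⟩
          X * (η * (Q * Q ^ N))  ∎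

        q^n≈ : q ^ n ≈ q * Q ^ N
        q^n≈ = *-congˡ (sym (Q^≈q^ N))

        modulus≈ : (1# - a * q ^ n) * (a - η * q ^ n) ≈ u * (a * Q ^ N)
        modulus≈ = begin
          (1# - a * q ^ n) * (a - η * q ^ n)
            ≈⟨ *-cong (+-congˡ (-‿cong (*-congˡ q^n≈))) (+-congˡ (-‿cong (*-congˡ q^n≈))) ⟩
          (1# - a * (q * s)) * (a - η * (q * s))
            -- The four monomials are X, Y, -x and -y times a Qᴺ, in this order; the first is
            -- recognised through X Qᴺ = 1 and the last through y a = ηq.
            ≈⟨ solve 4 (λ a q s h → (:1 :- a :* (q :* s)) :* (a :- h :* (q :* s))
                 := :1 :* a :+ h :* (q :* (q :* :1) :* s) :* (a :* s) :- a :* q :* (a :* s) :- h :* q :* s) refl a q s η ⟩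
          1# * a + Y * (a * s) - x * (a * s) - η * q * s
            ≈⟨ +-cong (+-congʳ (+-congʳ (*-congʳ X-inverse))) (-‿cong (*-congʳ ya≈ηq)) ⟨
          X * s * a + Y * (a * s) - x * (a * s) - y * a * s
            ≈⟨ solve 6 (λ X Y x y a s → X :* s :* a :+ Y :* (a :* s) :- x :* (a :* s) :- y :* a :* s
                 := (X :+ Y :- x :- y) :* (a :* s)) refl X Y x y a s ⟩
          u * (a * s) ∎
          where
          s : Carrier
          s = Q ^ N

        -- The converse direction is the one used: `a⁻¹ * X` inverts `a * Q ^ N` inside `S`, so an
        -- `S`-multiple of `u` is an `S`-multiple of the modulus.
        u≈ : u ≈ (1# - a * q ^ n) * (a - η * q ^ n) * (a⁻¹ * X)
        u≈ = begin
          u                              ≈⟨ solve 1 (λ u → u := u :* (:1 :* :1)) refl u ⟩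
          u * (1# * 1#)                  ≈⟨ *-congˡ (*-cong a-inverse X-inverse) ⟨
          u * (a * a⁻¹ * (X * Q ^ N))
            ≈⟨ solve 5 (λ u a b X s → u :* (a :* b :* (X :* s)) := u :* (a :* s) :* (b :* X)) refl u a a⁻¹ X (Q ^ N) ⟩
          u * (a * Q ^ N) * (a⁻¹ * X)    ≈⟨ *-congʳ modulus≈ ⟨
          (1# - a * q ^ n) * (a - η * q ^ n) * (a⁻¹ * X) ∎

        Y^N≈ : Y ^ N ≈ η ^ N * q ^ (2 ℕ.* (suc N ℕ.* N))
        Y^N≈ = begin
          (η * Q ^ suc N) ^ N                ≈⟨ ^-distrib-* η (Q ^ suc N) N ⟩
          η ^ N * (Q ^ suc N) ^ N            ≈⟨ *-congˡ (^-assocʳ Q (suc N) N) ⟩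
          η ^ N * Q ^ (suc N ℕ.* N)          ≈⟨ *-congˡ (Q^≈q^ (suc N ℕ.* N)) ⟩
          η ^ N * q ^ (2 ℕ.* (suc N ℕ.* N))  ∎

      series-congruence : ∃[ h ] S h × series e e-inverse n x y - η ^ N * q ^ (2 ℕ.* (suc N ℕ.* N)) ≈
                          (1# - a * q ^ n) * (a - η * q ^ n) * h
      series-congruence = a⁻¹ * X * g , *∈ (*∈ a⁻¹∈ (^∈ (^∈ q⁻¹∈ 2) N)) (proj₁ (proj₂ cong)) , (begin
        series e e-inverse n x y - B
          ≈⟨ +-cong (proj₂ (proj₂ cong)) (-‿cong (sym Y^N≈)) ⟩
        series e e-inverse n X Y + u * g - Y ^ N
          -- The sum runs up to k = 2N although the terms vanish beyond k = N; Chu-Vandermonde only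
          -- asks for N < n.
          ≈⟨ +-congʳ (+-congʳ (chuVandermonde e e-inverse Q⁻¹ Q⁻¹-inverse N n Y (s≤s (ℕ.m≤m+n N _)))) ⟩
        Y ^ N + u * g - Y ^ N
          ≈⟨ solve 2 (λ z v → z :+ v :- z := v) refl (Y ^ N) (u * g) ⟩
        u * g
          ≈⟨ *-congʳ u≈ ⟩
        M * (a⁻¹ * X) * g
          ≈⟨ *-assoc M (a⁻¹ * X) g ⟩
        M * (a⁻¹ * X * g) ∎)
        where
        M B : Carrier
        M = (1# - a * q ^ n) * (a - η * q ^ n)
        B = η ^ N * q ^ (2 ℕ.* (suc N ℕ.* N))
        cong : ∃[ g ] S g × series e e-inverse n x y ≈ series e e-inverse n X Y + u * g
        cong = series-congruent e e-inverse S-isSubring (^∈ q∈ 2) e∈ (*∈ a∈ q∈) y∈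
               (^∈ (^∈ q⁻¹∈ 2) N) (*∈ η∈ (^∈ (^∈ q∈ 2) (suc N))) xy≈XY n
        g : Carrier
        g = proj₁ cong

-- Fractions with denominators in a multiplicative set, and congruences between them.

module LocalizedCongruence (A : DecidableDomain c ℓ) where

  private
    module A = DecidableDomain A
  open FractionField A
  open FractionRing A
  private
    module K = CommutativeRing fractionRing
  open RawSemiringDefinitions (RawRing.rawSemiring (CommutativeRing.rawRing (DecidableDomain.commutativeRing A)))
    using (Coprime) renaming (_^_ to _^ₚ_)
  open RawRing fractionRawRing using (_+_; _*_; -_; 1#)
  open RawSemiringDefinitions (RawRing.rawSemiring fractionRawRing) using (_^_; sum)
  open K using (_≈_; refl; sym; trans; +-cong; +-congˡ; *-cong; *-congˡ; *-congʳ; -‿cong)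
  open Exponentiation K.commutativeSemiring using (^-assocʳ; ^-congˡ)
  open Summation K.semiring using (sum-cong-≋)
  open RingProperties K.ring using (-1*x≈-x; -‿distribˡ-*)
  open ClearingDenominators fractionRing
  open SetoidReasoning K.setoid

  module _ {p} {Den : A.Carrier → Set p} (Den-≉0 : ∀ {D} → Den D → A._≉_ D A.0#)
           (1∈ : Den A.1#) (*∈ : ∀ {D E} → Den D → Den E → Den (D A.* E)) where

    -- An equation is required instead of a condition on the stored denominator, which is unreduced;
    -- this makes the predicate invariant under `≈`.
    Localized : Fraction → Set _
    Localized x = ∃[ C ] ∃[ D ] Den D × x * embed D ≈ embed C

    embed-localized : ∀ p → Localized (embed p)
    embed-localized p = p , A.1# , 1∈ , K.*-identityʳ (embed p)

    localized-resp : ∀ {x y} → x ≈ y → Localized y → Localized x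
    localized-resp {x} {y} x≈y (C , D , D∈ , yD≈C) = C , D , D∈ , trans (*-congʳ {embed D} x≈y) yD≈C

    localized-isSubring : IsSubring fractionRing Localized
    localized-isSubring = record
      { 0∈ = embed-localized A.0#
      ; 1∈ = embed-localized A.1#
      ; +∈ = λ { {x} {y} (C , D , D∈ , xD≈C) (C′ , E , E∈ , yE≈C′) →
          C A.* E A.+ C′ A.* D , D A.* E , *∈ D∈ E∈ , (begin
            (x + y) * embed (D A.* E)                 ≈⟨ *-congˡ {x + y} (embed-* D E) ⟩
            (x + y) * (embed D * embed E)             ≈⟨ clear-+ x y (embed D) (embed E) xD≈C yE≈C′ ⟩
            embed C * embed E + embed C′ * embed D    ≈⟨ +-cong (embed-* C E) (embed-* C′ D) ⟨
            embed (C A.* E) + embed (C′ A.* D)        ≈⟨ embed-+ (C A.* E) (C′ A.* D) ⟨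
            embed (C A.* E A.+ C′ A.* D)              ∎) }
      ; *∈ = λ { {x} {y} (C , D , D∈ , xD≈C) (C′ , E , E∈ , yE≈C′) →
          C A.* C′ , D A.* E , *∈ D∈ E∈ , (begin
            x * y * embed (D A.* E)        ≈⟨ *-congˡ {x * y} (embed-* D E) ⟩
            x * y * (embed D * embed E)    ≈⟨ clear-* x y (embed D) (embed E) xD≈C yE≈C′ ⟩
            embed C * embed C′             ≈⟨ embed-* C C′ ⟨
            embed (C A.* C′)               ∎) }
      ; -∈ = λ { {x} (C , D , D∈ , xD≈C) → A.- C , D , D∈ , clear-neg x (embed D) xD≈C }
      }

    invF-localized : ∀ {x D} → Den D → x ≈ embed D → Localized (invF x)
    invF-localized {x} {D} D∈ x≈D = A.1# , D , D∈ , (begin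
      invF x * embed D  ≈⟨ *-congˡ {invF x} x≈D ⟨
      invF x * x        ≈⟨ K.*-comm (invF x) x ⟩
      x * invF x        ≈⟨ invF-inverseʳ (Den-≉0 D∈) x≈D ⟩
      1#                ∎)

    module _ {aₚ qₚ : A.Carrier} (aₚ∈ : Den aₚ) (qₚ∈ : Den qₚ) (1-qₚ^∈ : ∀ k → Den (A.1# A.- qₚ ^ₚ suc k))
             {a q : Fraction} (a≈ : a ≈ embed aₚ) (q≈ : q ≈ embed qₚ) where

      private
        Q : Fraction
        Q = q ^ 2

      open QSeries fractionRing Q using (poch; term; series)

      Q^≈q^ : ∀ k → Q ^ k ≈ q ^ (2 ℕ.* k)
      Q^≈q^ k = ^-assocʳ q 2 k

      -- Identifies (Q;Q)ₖ with an admissible denominator, so that its `invF` is a true inverse and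
      -- lies in the localization.
      poch-Q : ∀ k → ∃[ D ] Den D × poch Q k ≈ embed D
      poch-Q zero    = A.1# , 1∈ , refl
      poch-Q (suc k) with poch-Q k
      -- `k ℕ.+ 1 ℕ.* suc k` is the predecessor of `2 ℕ.* suc k` as the latter computes, so the new
      -- factor is 1 - q²ᵏ⁺².
      ... | D , D∈ , eq = D A.* (A.1# A.- s) , *∈ D∈ (1-qₚ^∈ (k ℕ.+ 1 ℕ.* suc k)) , (begin
          poch Q k * (1# + - (Q ^ suc k))          ≈⟨ *-cong eq (+-congˡ {1#} (-‿cong Q^≈)) ⟩
          embed D * (1# + - embed s)               ≈⟨ *-congˡ {embed D} (embed-+ A.1# (A.- s)) ⟨
          embed D * embed (A.1# A.- s)             ≈⟨ embed-* D (A.1# A.- s) ⟨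
          embed (D A.* (A.1# A.- s))               ∎)
        where
        s : A.Carrier
        s = qₚ ^ₚ (2 ℕ.* suc k)
        Q^≈ : Q ^ suc k ≈ embed s
        Q^≈ = begin
          Q ^ suc k                    ≈⟨ Q^≈q^ (suc k) ⟩
          q ^ (2 ℕ.* suc k)            ≈⟨ ^-congˡ (2 ℕ.* suc k) q≈ ⟩
          embed qₚ ^ (2 ℕ.* suc k)     ≈⟨ embed-^ qₚ (2 ℕ.* suc k) ⟨
          embed s                      ∎

      e : ℕ → Fraction
      e k = invF (poch Q k)

      e-inverse : ∀ k → poch Q k * e k ≈ 1#
      e-inverse k = let (D , D∈ , eq) = poch-Q k in invF-inverseʳ (Den-≉0 D∈) eq

      e-localized : ∀ k → Localized (e k)
      e-localized k = let (D , D∈ , eq) = poch-Q k in invF-localized D∈ eq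

      a-localized : Localized a
      a-localized = localized-resp a≈ (embed-localized aₚ)

      q-localized : Localized q
      q-localized = localized-resp q≈ (embed-localized qₚ)

      module _ (N : ℕ) (ηₚ : A.Carrier) where

        private
          n : ℕ
          n = 1 ℕ.+ 2 ℕ.* N

          η : Fraction
          η = embed ηₚ

          w : A.Carrier
          w = qₚ ^ₚ n

        modulus : A.Carrier
        modulus = (A.1# A.- aₚ A.* w) A.* (aₚ A.- ηₚ A.* w)

        embed-modulus : embed modulus ≈ (1# + - (a * q ^ n)) * (a + - (η * q ^ n))
        embed-modulus = begin
          embed modulus
            ≈⟨ embed-* (A.1# A.- aₚ A.* w) (aₚ A.- ηₚ A.* w) ⟩
          embed (A.1# A.- aₚ A.* w) * embed (aₚ A.- ηₚ A.* w)
            ≈⟨ *-cong (embed-minus A.1# aₚ) (embed-minus aₚ ηₚ) ⟩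
          (1# + - (embed aₚ * embed w)) * (embed aₚ + - (η * embed w))
            ≈⟨ *-cong (+-congˡ {1#} (-‿cong (*-cong a≈ w≈))) (+-cong a≈ (-‿cong (*-congˡ {η} w≈))) ⟨
          (1# + - (a * q ^ n)) * (a + - (η * q ^ n)) ∎
          where
          embed-minus : ∀ u v → embed (u A.- v A.* w) ≈ embed u + - (embed v * embed w)
          embed-minus u v = trans (embed-+ u (A.- (v A.* w))) (+-congˡ {embed u} (-‿cong (embed-* v w)))
          w≈ : q ^ n ≈ embed w
          w≈ = trans (^-congˡ n q≈) (sym (embed-^ qₚ n))

        -- The C and D that clear `h` serve directly as the witnesses: every admissible denominator
        -- is coprime to P, so D need not be reduced.
        mod-localized : ∀ {S B P h} → P A.≈ modulus → (∀ {D} → Den D → Coprime D P) → Localized h →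
                        S + - B ≈ (1# + - (a * q ^ n)) * (a + - (η * q ^ n)) * h → S ≡ B [mod P ]
        mod-localized {S} {B} {P} {h} P≈ coprime (C , D , D∈ , hD≈C) eq =
          C , D , Den-≉0 D∈ , coprime D∈ , (begin
            S + - B
              ≈⟨ eq ⟩
            (1# + - (a * q ^ n)) * (a + - (η * q ^ n)) * h
              ≈⟨ *-congʳ {h} (trans (embed-cong P≈) embed-modulus) ⟨
            embed P * h
              ≈⟨ *-congˡ {embed P} {h} {fraction C D (Den-≉0 D∈)} (≃-fraction (Den-≉0 D∈) hD≈C) ⟩
            embed P * fraction C D (Den-≉0 D∈) ∎)

        congruence : ∀ {S B P y} → (∀ {D} → Den D → Coprime D P) → y * a ≈ η * q →
                     S ≈ series e e-inverse n (a * q) y →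
                     B ≈ η ^ N * q ^ (2 ℕ.* (suc N ℕ.* N)) → P A.≈ modulus → S ≡ B [mod P ]
        congruence {S} {B} {P} {y} coprime ya≈ηq S≈ B≈ P≈ =
          let (h , h∈ , eq) = main in
          mod-localized {S} {B} {P} {h} P≈ coprime h∈ (trans (+-cong S≈ (-‿cong B≈)) eq)
          where
          y-localized : Localized y
          y-localized = ηₚ A.* qₚ , aₚ , aₚ∈ , (begin
            y * embed aₚ       ≈⟨ *-congˡ {y} a≈ ⟨
            y * a              ≈⟨ ya≈ηq ⟩
            η * q              ≈⟨ *-congˡ {η} q≈ ⟩
            η * embed qₚ       ≈⟨ embed-* ηₚ qₚ ⟨
            embed (ηₚ A.* qₚ)  ∎)
          main : ∃[ h ] Localized h × series e e-inverse n (a * q) y + - (η ^ N * q ^ (2 ℕ.* (suc N ℕ.* N))) ≈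
                 (1# + - (a * q ^ n)) * (a + - (η * q ^ n)) * h
          main = SeriesCongruence.series-congruence fractionRing localized-isSubring
            {a} {invF a} {q} {invF q}
            a-localized (invF-localized aₚ∈ a≈) q-localized (invF-localized qₚ∈ q≈)
            (invF-inverseʳ (Den-≉0 aₚ∈) a≈) (invF-inverseʳ (Den-≉0 qₚ∈) q≈)
            e e-inverse e-localized N {y} {η} y-localized (embed-localized ηₚ) ya≈ηq

      q÷a-cancel : q * invF a * a ≈ q
      q÷a-cancel = begin
        q * invF a * a    ≈⟨ K.*-assoc q (invF a) a ⟩
        q * (invF a * a)  ≈⟨ *-congˡ {q} (K.*-comm (invF a) a) ⟩
        q * (a * invF a)  ≈⟨ *-congˡ {q} (invF-inverseʳ (Den-≉0 aₚ∈) a≈) ⟩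
        q * 1#            ≈⟨ K.*-identityʳ q ⟩
        q                 ∎

      -- f y k is (y;q²)ₖ; keeping f, a and q abstract avoids evaluating concrete
      -- rational functions when this is applied to ℚ[q][a].
      module _ (f : Fraction → ℕ → Fraction) (f-zero : ∀ y → f y 0 ≡ 1#)
               (f-suc : ∀ y k → f y (suc k) ≡ f y k * (1# + - (y * (q ^ 2) ^ k))) where

        f≡poch : ∀ y k → f y k ≡ poch y k
        f≡poch y zero    = f-zero y
        f≡poch y (suc k) = ≡.trans (f-suc y k) (≡.cong (_* (1# + - (y * Q ^ k))) (f≡poch y k))

        sum≈series : ∀ n y → sum {n} (λ i → f (a * q) (toℕ i) * f y (toℕ i) * q ^ (2 ℕ.* toℕ i) * invF (f (q ^ 2) (toℕ i)))
                           ≈ series e e-inverse n (a * q) y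
        sum≈series n y = sum-cong-≋ {n} (λ i → summand≈ (toℕ i))
          where
          summand≈ : ∀ k → f (a * q) k * f y k * q ^ (2 ℕ.* k) * invF (f (q ^ 2) k) ≈ term e e-inverse (a * q) y k
          summand≈ k rewrite f≡poch (a * q) k | f≡poch y k | f≡poch (q ^ 2) k =
            *-congʳ {e k} (*-congˡ {poch (a * q) k * poch y k} (sym (Q^≈q^ k)))

        -- The length and exponents are variables tied to N by equations; matching on these removes
        -- the divisions by 2 that appear in the final exponents.
        congruence-minus : ∀ {n N i j} → n ≡ 1 ℕ.+ 2 ℕ.* N → i ≡ N → j ≡ 2 ℕ.* (suc N ℕ.* N) →
          (∀ {D} → Den D → Coprime D ((A.1# A.- aₚ A.* qₚ ^ₚ n) A.* (aₚ A.+ qₚ ^ₚ n))) →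
          sum {n} (λ i → f (a * q) (toℕ i) * f (- (q * invF a)) (toℕ i) * q ^ (2 ℕ.* toℕ i) * invF (f (q ^ 2) (toℕ i)))
          ≡ (- 1#) ^ i * q ^ j
          [mod (A.1# A.- aₚ A.* qₚ ^ₚ n) A.* (aₚ A.+ qₚ ^ₚ n) ]
        congruence-minus {N = N} ≡.refl ≡.refl ≡.refl coprime =
          congruence N (A.- A.1#) {y = - (q * invF a)} coprime ya≈
            (sum≈series (1 ℕ.+ 2 ℕ.* N) (- (q * invF a))) refl
            (A.*-congˡ {A.1# A.- aₚ A.* w} (A.+-congˡ {aₚ} w≈))
          where
          open RingProperties A.ring using () renaming (-1*x≈-x to -1*x≈-xₚ; -‿involutive to -‿involutiveₚ)
          w : A.Carrier
          w = qₚ ^ₚ (1 ℕ.+ 2 ℕ.* N)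
          -- Rewrites a + qⁿ as a - ηqⁿ with η = -1.
          w≈ : w A.≈ A.- (A.- A.1# A.* w)
          w≈ = A.sym (A.trans (A.-‿cong (-1*x≈-xₚ w)) (-‿involutiveₚ w))
          ya≈ : - (q * invF a) * a ≈ - 1# * q
          ya≈ = begin
            - (q * invF a) * a      ≈⟨ -‿distribˡ-* (q * invF a) a ⟨
            - (q * invF a * a)      ≈⟨ -‿cong q÷a-cancel ⟩
            - q                     ≈⟨ -1*x≈-x q ⟨
            - 1# * q                ∎

        congruence-plus : ∀ {n N j} → n ≡ 1 ℕ.+ 2 ℕ.* N → j ≡ 2 ℕ.* (suc N ℕ.* N) →
          (∀ {D} → Den D → Coprime D ((A.1# A.- aₚ A.* qₚ ^ₚ n) A.* (aₚ A.- qₚ ^ₚ n))) →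
          sum {n} (λ i → f (a * q) (toℕ i) * f (q * invF a) (toℕ i) * q ^ (2 ℕ.* toℕ i) * invF (f (q ^ 2) (toℕ i)))
          ≡ q ^ j
          [mod (A.1# A.- aₚ A.* qₚ ^ₚ n) A.* (aₚ A.- qₚ ^ₚ n) ]
        congruence-plus {N = N} ≡.refl ≡.refl coprime =
          congruence N A.1# {y = q * invF a} coprime (trans q÷a-cancel (sym (K.*-identityˡ q)))
            (sum≈series (1 ℕ.+ 2 ℕ.* N) (q * invF a)) B≈
            (A.*-congˡ {A.1# A.- aₚ A.* w} (A.+-congˡ {aₚ} (A.-‿cong (A.sym (A.*-identityˡ w)))))
          where
          w : A.Carrier
          w = qₚ ^ₚ (1 ℕ.+ 2 ℕ.* N)
          B : Fraction
          B = q ^ (2 ℕ.* (suc N ℕ.* N))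
          B≈ : B ≈ 1# ^ N * B
          B≈ = sym (trans (*-congʳ {B} (1^k≈1 fractionRing N)) (K.*-identityˡ B))

-- Arithmetic of odd n.

odd : ∀ {n} → ¬ (2 ∣ n) → ∃[ N ] n ≡ 1 ℕ.+ 2 ℕ.* N
odd {n} 2∤n with parity n
  where
  parity : ∀ n → ∃[ N ] (n ≡ 2 ℕ.* N ⊎ n ≡ 1 ℕ.+ 2 ℕ.* N)
  parity zero    = 0 , inj₁ ≡.refl
  parity (suc n) with parity n
  ... | N , inj₁ e = N , inj₂ (≡.cong suc e)
  ... | N , inj₂ e = suc N , inj₁ (≡.trans (≡.cong suc e) (≡.sym (ℕ.*-suc 2 N)))
... | N , inj₁ e = contradiction (divides N (≡.trans e (ℕ.*-comm 2 N))) 2∤n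
... | N , inj₂ e = N , e

half-pred : ∀ N → (1 ℕ.+ 2 ℕ.* N ∸ 1) / 2 ≡ N
half-pred N = ≡.trans (≡.cong (_/ 2) (ℕ.*-comm 2 N)) (m*n/n≡m N 2)

-- (2N + 1)² - 1 = 4N(N + 1), which is how the exponent of (ηQᴺ⁺¹)ᴺ becomes (n² - 1)/2.
half-square-pred : ∀ N → ((1 ℕ.+ 2 ℕ.* N) ^ℕ 2 ∸ 1) / 2 ≡ 2 ℕ.* (suc N ℕ.* N)
half-square-pred N = ≡.trans
  (≡.cong (λ k → (k ∸ 1) / 2)
    (solve 1 (λ N → (con 1 :+ con 2 :* N) :^ 2 := con 1 :+ (con 2 :* ((con 1 :+ N) :* N)) :* con 2) ≡.refl N))
  (m*n/n≡m (2 ℕ.* (suc N ℕ.* N)) 2)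
  where open +-*-Solver

-- Specialisation to ℚ[q][a].

private
  module ℚ[q] = DecidableDomain ℚ[q]
  module ℚX = Polynomial (DecidableDomain.commutativeRing ℚ-domain)
  open Exponentiation ℚ[q].commutativeSemiring using () renaming (_^_ to _^q_)

  X≉0 : ℚ[q]._≉_ ℚX.X ℚ[q].0#
  X≉0 e = DecidableDomain.1≉0 ℚ-domain (ℚX.coeff≈ e 1)

  -- Compare constant terms: that of X · Xᵏ is 0. This makes each 1 - qᵏ⁺¹ an admissible
  -- denominator.
  X^≉1 : ∀ k → ℚ[q]._≉_ (ℚX.X ^q suc k) ℚ[q].1#
  X^≉1 k e = DecidableDomain.1≉0 ℚ-domain
    (≡.trans (≡.sym (ℚX.coeff≈ e 0)) (ℚX.coeff≈ (PolynomialDivisibility.X-⊗ ℚ-domain (ℚX.X ^q k)) 0))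

open import Defs
open FractionField ℚ[q][a] using (_≃_)
open FractionRing ℚ[q][a] using (fractionRing)
open MonomialDenominators ℚ[q]
open LocalizedCongruence ℚ[q][a] using (congruence-minus; congruence-plus)

private
  a≃ : a ≃ embed aₚ
  a≃ = CommutativeRing.refl fractionRing {a}

  q≃ : q ≃ embed qₚ
  q≃ = CommutativeRing.refl fractionRing {q}

  qPoch-suc : ∀ y k → qPoch y (q ^ 2) (suc k) ≡ qPoch y (q ^ 2) k * (1# + (- (y * (q ^ 2) ^ k)))
  qPoch-suc y k = ≡.refl

theorem4p5 : (n : ℕ) → 0 < n → ¬ (2 ∣ n) →
    ( sum {n} (λ i → let k = toℕ i in
    (qPoch (a * q) (q ^ 2) k * qPoch (- (q ÷ a)) (q ^ 2) k * q ^ (2 *ℕ k)) ÷ qPoch (q ^ 2) (q ^ 2) k)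
    ≡ (- 1#) ^ ((n ∸ 1) / 2) * q ^ ((n ^ℕ 2 ∸ 1) / 2)
    [mod (1ₚ -ₚ aₚ *ₚ qₚ ^ₚ n) *ₚ (aₚ +ₚ qₚ ^ₚ n) ] )
    ×
    ( sum {n} (λ i → let k = toℕ i in
    (qPoch (a * q) (q ^ 2) k * qPoch (q ÷ a) (q ^ 2) k * q ^ (2 *ℕ k)) ÷ qPoch (q ^ 2) (q ^ 2) k)
    ≡ q ^ ((n ^ℕ 2 ∸ 1) / 2)
    [mod (1ₚ -ₚ aₚ *ₚ qₚ ^ₚ n) *ₚ (aₚ -ₚ qₚ ^ₚ n) ] )
theorem4p5 n _ 2∤n =
  congruence-minus {Den = Monomial} monomial-≉0 monomial-1 monomial-* monomial-X (monomial-q X≉0)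
    (monomial-1-q^ X≉0 X^≉1) {a} {q} a≃ q≃ (λ y → qPoch y (q ^ 2)) (λ _ → ≡.refl) qPoch-suc
    {n} {N} n≡ half half-square (coprime-plus X≉0 n) ,
  congruence-plus {Den = Monomial} monomial-≉0 monomial-1 monomial-* monomial-X (monomial-q X≉0)
    (monomial-1-q^ X≉0 X^≉1) {a} {q} a≃ q≃ (λ y → qPoch y (q ^ 2)) (λ _ → ≡.refl) qPoch-suc
    {n} {N} n≡ half-square (coprime-minus X≉0 n)
  where
  N : ℕ
  N = proj₁ (odd 2∤n)
  n≡ : n ≡ 1 ℕ.+ 2 ℕ.* N
  n≡ = proj₂ (odd 2∤n)
  half : (n ∸ 1) / 2 ≡ N
  half = ≡.trans (≡.cong (λ m → (m ∸ 1) / 2) n≡) (half-pred N)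
  half-square : (n ^ℕ 2 ∸ 1) / 2 ≡ 2 ℕ.* (suc N ℕ.* N)
  half-square = ≡.trans (≡.cong (λ m → (m ^ℕ 2 ∸ 1) / 2) n≡) (half-square-pred N)
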